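{- Let $n$ be a positive integer, let $G_1,\ldots,G_n$ be an arbitrary sequence of finite graphs, and let $\mathbf{G} := G_1\square\cdots\square G_n$. For every $\emptyset\neq A\subseteq V(\mathbf{G})$, $$e_{\mathbf{G}}(A,A^c)\ge |A|\cdot\min\left\{\sum_{i=1}^n\psi_{G_i}(h_i) : 0\le h_i\le\log|V(G_i)| \text{ for all } i, \text{ and } \sum_{i=1}^n h_i=\log|A|\right\}.$$ In particular, if $G_1=\cdots=G_n=G$, then $$e_{\mathbf{G}}(A,A^c)\ge |A|\cdot n\cdot\psi_G\bigl((\log|A|)/n\bigr).$$
   Context: $\log$ is the natural logarithm and $[m]$ denotes $\{1,\dots,m\}$. For a graph $G$ and $A\subseteq V(G)$, $A^c = V(G)\setminus A$ and $e_G(A,A^c)$ is the number of edges of $G$ with exactly one endpoint in $A$. For an $m$-vertex graph $G$ and $k\in[m]$, $i_k(G) := \min\{e_G(A,A^c)/|A| : A\subseteq V(G),\ |A|=k\}$. The function $\psi_G\colon[0,\log m]\to[0,\infty)$ is the convex minorant of the points $(\log k, i_k(G))$, i.e. the largest convex function on $[0,\log m]$ satisfying $\psi_G(\log k)\le i_k(G)$ for all $k\in[m]$. The product graph $G_1\square\cdots\square G_n$ has vertex set $V(G_1)\times\cdots\times V(G_n)$, and its edges are all pairs $\{u,v\}$ for which there is an index $j\in[n]$ such that $u_jv_j\in E(G_j)$ and $u_l=v_l$ for all $l\neq j$. -}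

module Defs where

open import Algebra.Bundles using (CommutativeRing)
open import Algebra.Structures using (IsCommutativeRing)
open import Data.Empty using (⊥-elim)
open import Data.Fin as Fin using (Fin; zero; suc)
open import Data.Fin.Properties as Fin using (1↔⊤; *↔×; any?; all?)
open import Data.Fin.Subset using (Subset; inside; outside; ⊥; ∣_∣; _∈_; _∉_)
open import Data.Fin.Subset.Properties using (_∈?_; anySubset?; ∣⊥∣≡0)
open import Data.List using (List; length; filter; allFin; cartesianProduct)
open import Data.Nat as ℕ using (ℕ; zero; suc; z≤n; s≤s)
import Data.Nat.Properties as ℕ
open import Data.Product using (∃; _×_; _,_; proj₁; proj₂)
open import Data.Product.Function.NonDependent.Propositional using (_×-↔_)
open import Data.Sum using (_⊎_; inj₁; inj₂)
open import Data.Unit using (⊤; tt)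
open import Data.Vec using ([]; _∷_)
open import Function using (_∘_; _↔_; Inverse)
open import Function.Construct.Composition using (_↔-∘_)
open import Function.Construct.Symmetry using (↔-sym)
open import Function.Properties.Inverse using (Inverse⇒Injection)
open import Level using (0ℓ)
open import Relation.Binary
  using (Rel; Decidable; DecidableEquality; Symmetric; Irreflexive; IsDecTotalOrder)
open import Relation.Binary.PropositionalEquality
open import Relation.Nullary using (¬_; Dec; yes; no)
open import Relation.Nullary.Decidable using (_×-dec_; _⊎-dec_; _→-dec_; ¬?; via-injection)
import Relation.Unary as U

-- A finite simple graph.  Sets of vertices are represented by subsets of the
-- index set Fin order, vertex i being the i-th vertex.
record Graph : Set₁ where
  field
    Vertex     : Set
    order      : ℕ
    enum       : Vertex ↔ Fin order
    Adj        : Rel Vertex 0ℓ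
    adj?       : Decidable Adj
    adj-sym    : Symmetric Adj
    adj-irrefl : Irreflexive _≡_ Adj

  vertex : Fin order → Vertex
  vertex = Inverse.from enum

  _≟_ : DecidableEquality Vertex
  _≟_ = via-injection (Inverse⇒Injection enum) Fin._≟_

  -- The edge {vertex i, vertex j} is listed once, with i < j.
  edges : List (Fin order × Fin order)
  edges = filter (λ (i , j) → (i Fin.<? j) ×-dec adj? (vertex i) (vertex j))
                 (cartesianProduct (allFin order) (allFin order))

  ExactlyOneIn : Subset order → Fin order × Fin order → Set
  ExactlyOneIn A (i , j) = (i ∈ A × j ∉ A) ⊎ (i ∉ A × j ∈ A)

  exactlyOneIn? : ∀ A → U.Decidable (ExactlyOneIn A)
  exactlyOneIn? A (i , j) =
    ((i ∈? A) ×-dec ¬? (j ∈? A)) ⊎-dec (¬? (i ∈? A) ×-dec (j ∈? A))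

  -- e_G(A , Aᶜ)
  boundary : Subset order → ℕ
  boundary A = length (filter (exactlyOneIn? A) edges)

open Graph

Tuple : ∀ {n} → (Fin n → Graph) → Set
Tuple {zero}  Gs = ⊤
Tuple {suc n} Gs = Vertex (Gs zero) × Tuple (Gs ∘ suc)

component : ∀ {n} (Gs : Fin n → Graph) → Tuple Gs → ∀ j → Vertex (Gs j)
component Gs (v , vs) zero    = v
component Gs (v , vs) (suc j) = component (Gs ∘ suc) vs j

tupleCount : ∀ {n} → (Fin n → Graph) → ℕ
tupleCount {zero}  Gs = 1
tupleCount {suc n} Gs = order (Gs zero) ℕ.* tupleCount (Gs ∘ suc)

tupleEnum : ∀ {n} (Gs : Fin n → Graph) → Tuple Gs ↔ Fin (tupleCount Gs)
tupleEnum {zero}  Gs = ↔-sym 1↔⊤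
tupleEnum {suc n} Gs = ↔-sym *↔× ↔-∘ (enum (Gs zero) ×-↔ tupleEnum (Gs ∘ suc))

□ : ∀ {n} → (Fin n → Graph) → Graph
□ {n} Gs = record
  { Vertex     = Tuple Gs
  ; order      = tupleCount Gs
  ; enum       = tupleEnum Gs
  ; Adj        = λ u v → ∃ λ j → Adj (Gs j) (π u j) (π v j)
                               × (∀ l → l ≢ j → π u l ≡ π v l)
  ; adj?       = λ u v → any? λ j → adj? (Gs j) (π u j) (π v j)
                   ×-dec all? λ l → ¬? (l Fin.≟ j) →-dec _≟_ (Gs l) (π u l) (π v l)
  ; adj-sym    = λ (j , a , eq) → j , adj-sym (Gs j) a , λ l l≢j → sym (eq l l≢j)
  ; adj-irrefl = λ { refl (j , a , _) → adj-irrefl (Gs j) refl a }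
  }
  where π = component Gs

-- The real numbers, given (uniquely up to isomorphism) as a Dedekind-complete
-- totally ordered field.  The value of 0# ⁻¹ is unspecified.
record CompleteOrderedField : Set₁ where
  infixl 6 _+_
  infixl 7 _*_
  infix  8 -_
  infix  9 _⁻¹
  infix  4 _≤_
  field
    ℝ                 : Set
    _+_ _*_           : ℝ → ℝ → ℝ
    -_ _⁻¹            : ℝ → ℝ
    0# 1#             : ℝ
    _≤_               : Rel ℝ 0ℓ
    isCommutativeRing : IsCommutativeRing _≡_ _+_ _*_ -_ 0# 1#
    0≢1               : 0# ≢ 1#
    *-inverseʳ        : ∀ x → x ≢ 0# → x * x ⁻¹ ≡ 1#
    isDecTotalOrder   : IsDecTotalOrder _≡_ _≤_
    +-monoˡ-≤         : ∀ z {x y} → x ≤ y → x + z ≤ y + z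
    *-nonneg          : ∀ {x y} → 0# ≤ x → 0# ≤ y → 0# ≤ x * y

  UpperBound : (ℝ → Set) → ℝ → Set
  UpperBound S b = ∀ x → S x → x ≤ b

  IsSupremum : (ℝ → Set) → ℝ → Set
  IsSupremum S s = UpperBound S s × (∀ b → UpperBound S b → s ≤ b)

  field
    complete : ∀ S → ∃ S → ∃ (UpperBound S) → ∃ (IsSupremum S)

  commutativeRing : CommutativeRing 0ℓ 0ℓ
  commutativeRing = record { isCommutativeRing = isCommutativeRing }

module Analysis (reals : CompleteOrderedField) where

  open CompleteOrderedField reals public
  open CommutativeRing commutativeRing public
    using (_-_; +-commutativeMonoid)
  open CommutativeRing commutativeRing
    using (+-identityˡ; +-identityʳ; *-identityˡ; *-identityʳ; *-assoc; *-comm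
          ; +-assoc; +-comm; distribʳ; zeroʳ; -‿inverseˡ; -‿inverseʳ)
  open import Algebra.Properties.CommutativeMonoid.Sum +-commutativeMonoid public
    using (sum)
  open import Algebra.Definitions.RawMonoid
    (CommutativeRing.+-rawMonoid commutativeRing) using () renaming (_×_ to _·_)
  open IsDecTotalOrder isDecTotalOrder
    using (_≤?_; total; antisym) renaming (refl to ≤-refl; trans to ≤-trans; reflexive to ≤-reflexive)
  open import Algebra.Properties.Ring (CommutativeRing.ring commutativeRing)
    using (x[y-z]≈xy-xz; -‿distribˡ-*; -‿distribʳ-*; -‿involutive)
  open import Algebra.Properties.CommutativeSemigroup
    (CommutativeRing.*-commutativeSemigroup commutativeRing)
    using (xy∙z≈xz∙y)

  fromℕ : ℕ → ℝ
  fromℕ n = n · 1#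

  IsMinimum : (ℝ → Set) → ℝ → Set
  IsMinimum S m = S m × (∀ x → S x → m ≤ x)

  ≤-respˡ : ∀ {x y z} → x ≡ y → x ≤ z → y ≤ z
  ≤-respˡ refl p = p

  ≤-respʳ : ∀ {x y z} → y ≡ z → x ≤ y → x ≤ z
  ≤-respʳ refl p = p

  +-mono : ∀ {a b c d} → a ≤ b → c ≤ d → a + c ≤ b + d
  +-mono {a} {b} {c} {d} p q = ≤-trans (+-monoˡ-≤ c p)
    (subst₂ _≤_ (+-comm c b) (+-comm d b) (+-monoˡ-≤ b q))

  y-x+x≡y : ∀ y x → y - x + x ≡ y
  y-x+x≡y y x = trans (+-assoc y (- x) x)
    (trans (cong (y +_) (-‿inverseˡ x)) (+-identityʳ y))

  ≤⇒0≤ : ∀ {x y} → x ≤ y → 0# ≤ y - x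
  ≤⇒0≤ {x} p = ≤-respˡ (-‿inverseʳ x) (+-monoˡ-≤ (- x) p)

  0≤⇒≤ : ∀ {x y} → 0# ≤ y - x → x ≤ y
  0≤⇒≤ {x} {y} p = subst₂ _≤_ (+-identityˡ x) (y-x+x≡y y x) (+-monoˡ-≤ x p)

  *-monoˡ : ∀ {a x y} → 0# ≤ a → x ≤ y → a * x ≤ a * y
  *-monoˡ {a} {x} {y} 0≤a p = 0≤⇒≤ (≤-respʳ (x[y-z]≈xy-xz a y x)
    (*-nonneg 0≤a (≤⇒0≤ p)))

  0≤x² : ∀ x → 0# ≤ x * x
  0≤x² x with total 0# x
  ... | inj₁ p = *-nonneg p p
  ... | inj₂ p = ≤-respʳ -x*-x≡x*x (*-nonneg 0≤-x 0≤-x)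
    where
    -x*-x≡x*x : - x * - x ≡ x * x
    -x*-x≡x*x = trans (sym (-‿distribˡ-* x (- x)))
      (trans (cong -_ (sym (-‿distribʳ-* x x))) (-‿involutive (x * x)))
    0≤-x = ≤-respʳ (+-identityˡ (- x)) (≤⇒0≤ p)

  0≤1 : 0# ≤ 1#
  0≤1 = ≤-respʳ (*-identityˡ 1#) (0≤x² 1#)

  fromℕ-nonneg : ∀ n → 0# ≤ fromℕ n
  fromℕ-nonneg zero    = ≤-refl
  fromℕ-nonneg (suc n) = ≤-respˡ (+-identityˡ 0#) (+-mono 0≤1 (fromℕ-nonneg n))

  1≤fromℕ : ∀ n → 1# ≤ fromℕ (suc n)
  1≤fromℕ n = ≤-respˡ (+-identityʳ 1#) (+-mono ≤-refl (fromℕ-nonneg n))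

  1≤⇒≢0 : ∀ {x} → 1# ≤ x → x ≢ 0#
  1≤⇒≢0 p refl = 0≢1 (antisym 0≤1 p)

  inv-nonneg : ∀ {x} → 0# ≤ x → x ≢ 0# → 0# ≤ x ⁻¹
  inv-nonneg {x} p x≢0 = ≤-respʳ eq (*-nonneg p (0≤x² (x ⁻¹)))
    where
    eq : x * (x ⁻¹ * x ⁻¹) ≡ x ⁻¹
    eq = trans (sym (*-assoc x _ _))
           (trans (cong (_* x ⁻¹) (*-inverseʳ x x≢0)) (*-identityˡ _))

  inv≤1 : ∀ {x} → 1# ≤ x → x ⁻¹ ≤ 1#
  inv≤1 {x} p = subst₂ _≤_ (*-identityʳ _)
    (trans (*-comm (x ⁻¹) x) (*-inverseʳ x (1≤⇒≢0 p)))
    (*-monoˡ (inv-nonneg (≤-trans 0≤1 p) (1≤⇒≢0 p)) p)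

  -- LowerSum a b s : s is the lower Darboux sum of t ↦ 1/t for some partition
  -- of [a , b] (for a > 0; the infimum of 1/t on [a , c] is 1/c).
  data LowerSum : ℝ → ℝ → ℝ → Set where
    []   : ∀ {a} → LowerSum a a 0#
    _∷_  : ∀ {a b c s} → a ≤ c → LowerSum c b s →
           LowerSum a b ((c - a) * c ⁻¹ + s)

  lowerSum-bound : ∀ {a b s} → 1# ≤ a → LowerSum a b s → s ≤ b - a
  lowerSum-bound {a} p [] = ≤-reflexive (sym (-‿inverseʳ a))
  lowerSum-bound {a} {b} p (_∷_ {c = c} q ss) = ≤-respʳ
    (trans (+-comm (c - a) (b - c))
      (trans (sym (+-assoc (b - c) c (- a))) (cong (_- a) (y-x+x≡y b c))))
    (+-mono
      (≤-respʳ (*-identityʳ _) (*-monoˡ (≤⇒0≤ q) (inv≤1 (≤-trans p q))))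
      (lowerSum-bound (≤-trans p q) ss))

  -- The integral of 1/t over [1 , x].
  ∫₁1/t : ∀ x → 1# ≤ x → ∃ (IsSupremum (LowerSum 1# x))
  ∫₁1/t x 1≤x = complete (LowerSum 1# x) (_ , 1≤x ∷ [])
                  (x - 1# , λ _ → lowerSum-bound ≤-refl)

  -- The natural logarithm of a positive integer; log 0 is a junk value.
  log : ℕ → ℝ
  log zero    = 0#
  log (suc k) = proj₁ (∫₁1/t (fromℕ (suc k)) (1≤fromℕ k))

  log-nonneg : ∀ k → 0# ≤ log k
  log-nonneg zero    = ≤-refl
  log-nonneg (suc k) = ≤-trans
    (≤-respʳ (sym (+-identityʳ _))
      (*-nonneg (≤⇒0≤ p) (inv-nonneg (≤-trans 0≤1 p) (1≤⇒≢0 p))))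
    (proj₁ (proj₂ (∫₁1/t _ p)) _ (p ∷ []))
    where p = 1≤fromℕ k

  log1≡0 : log 1 ≡ 0#
  log1≡0 = antisym
    (proj₂ (proj₂ (∫₁1/t _ (1≤fromℕ 0))) 0# λ s ss → ≤-respʳ
      (trans (cong (_- 1#) (+-identityʳ 1#)) (-‿inverseʳ 1#))
      (lowerSum-bound ≤-refl ss))
    (log-nonneg 1)

  argmin : ∀ {m} {P : Subset m → Set} → U.Decidable P → (f : Subset m → ℝ) →
           ∃ P → ∃ λ A → P A × (∀ B → P B → f A ≤ f B)
  argmin {zero}  P? f ([] , p) = [] , p , λ { [] _ → ≤-refl }
  argmin {suc m} {P} P? f (A₀ , p₀)
    with anySubset? (P? ∘ (inside ∷_)) | anySubset? (P? ∘ (outside ∷_))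
  ... | no ¬i | no ¬o = ⊥-elim (absurd A₀ p₀)
    where
    absurd : ∀ A → ¬ P A
    absurd (inside  ∷ A) p = ¬i (A , p)
    absurd (outside ∷ A) p = ¬o (A , p)
  ... | yes i | no ¬o with A , p , min ← argmin (P? ∘ (inside ∷_)) (f ∘ (inside ∷_)) i
    = inside ∷ A , p , λ { (inside  ∷ B) q → min B q
                         ; (outside ∷ B) q → ⊥-elim (¬o (B , q)) }
  ... | no ¬i | yes o with A , p , min ← argmin (P? ∘ (outside ∷_)) (f ∘ (outside ∷_)) o
    = outside ∷ A , p , λ { (inside  ∷ B) q → ⊥-elim (¬i (B , q))
                          ; (outside ∷ B) q → min B q }
  ... | yes i | yes o
    with A , p , min  ← argmin (P? ∘ (inside ∷_)) (f ∘ (inside ∷_)) i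
       | A′ , p′ , min′ ← argmin (P? ∘ (outside ∷_)) (f ∘ (outside ∷_)) o
    with total (f (inside ∷ A)) (f (outside ∷ A′))
  ... | inj₁ le = inside ∷ A , p , λ { (inside  ∷ B) q → min B q
                                     ; (outside ∷ B) q → ≤-trans le (min′ B q) }
  ... | inj₂ le = outside ∷ A′ , p′ , λ { (inside  ∷ B) q → ≤-trans le (min B q)
                                        ; (outside ∷ B) q → min′ B q }

  subset-of-size : ∀ {m k} → k ℕ.≤ m → ∃ λ (A : Subset m) → ∣ A ∣ ≡ k
  subset-of-size {m} z≤n = ⊥ , ∣⊥∣≡0 m
  subset-of-size (s≤s p) with A , eq ← subset-of-size p = inside ∷ A , cong suc eq

  BoundaryRatio : (G : Graph) → ℕ → ℝ → Set
  BoundaryRatio G k x = ∃ λ (A : Subset (order G)) →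
    ∣ A ∣ ≡ k × x ≡ fromℕ (boundary G A) * fromℕ ∣ A ∣ ⁻¹

  abstract
    minBoundaryRatio : ∀ G k → k ℕ.≤ order G → ∃ (IsMinimum (BoundaryRatio G k))
    minBoundaryRatio G k k≤m
      with A , eq , min ← argmin (λ A → ∣ A ∣ ℕ.≟ k)
                            (λ A → fromℕ (boundary G A) * fromℕ ∣ A ∣ ⁻¹)
                            (subset-of-size k≤m)
      = _ , (A , eq , refl) , λ { _ (B , eq′ , refl) → min B eq′ }

  -- i_k(G), meaningful for 1 ≤ k ≤ order G
  i : ∀ G k → k ℕ.≤ order G → ℝ
  i G k k≤m = proj₁ (minBoundaryRatio G k k≤m)

  InDomain : Graph → ℝ → Set
  InDomain G x = 0# ≤ x × x ≤ log (order G)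

  ConvexOn : (ℝ → Set) → (ℝ → ℝ) → Set
  ConvexOn D f = ∀ x y t → D x → D y → 0# ≤ t → t ≤ 1# →
    f (t * x + (1# - t) * y) ≤ t * f x + (1# - t) * f y

  -- Functions on [0 , log m] are represented by functions on ℝ whose values
  -- outside that interval are irrelevant.  The largest such function is
  -- automatically nonnegative on [0 , log m], as 0 is one of its competitors.
  IsConvexLowerBound : Graph → (ℝ → ℝ) → Set
  IsConvexLowerBound G f = ConvexOn (InDomain G) f ×
    (∀ k → 1 ℕ.≤ k → (k≤m : k ℕ.≤ order G) → f (log k) ≤ i G k k≤m)

  IsConvexMinorant : Graph → (ℝ → ℝ) → Set
  IsConvexMinorant G f = IsConvexLowerBound G f ×
    (∀ g → IsConvexLowerBound G g → ∀ x → InDomain G x → g x ≤ f x)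

  i-nonneg : ∀ G k → 1 ℕ.≤ k → (k≤m : k ℕ.≤ order G) → 0# ≤ i G k k≤m
  i-nonneg G (suc k) _ k≤m with minBoundaryRatio G (suc k) k≤m
  ... | _ , (A , eq , refl) , _ = *-nonneg (fromℕ-nonneg (boundary G A))
    (subst (λ l → 0# ≤ fromℕ l ⁻¹) (sym eq)
      (inv-nonneg (fromℕ-nonneg (suc k)) (1≤⇒≢0 (1≤fromℕ k))))

  zero-lowerBound : ∀ G → IsConvexLowerBound G (λ _ → 0#)
  zero-lowerBound G =
    (λ _ _ t _ _ _ _ → ≤-reflexive (sym
      (trans (cong₂ _+_ (zeroʳ t) (zeroʳ (1# - t))) (+-identityʳ 0#)))) ,
    i-nonneg G

  Values : Graph → ℝ → ℝ → Set
  Values G x y = ∃ λ f → IsConvexLowerBound G f × y ≡ f x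

  convex-domain : ∀ {G x y t} → InDomain G x → InDomain G y → 0# ≤ t → t ≤ 1# →
                  InDomain G (t * x + (1# - t) * y)
  convex-domain {G} {x} {y} {t} (p , q) (p′ , q′) 0≤t t≤1 =
    ≤-respˡ (+-identityʳ 0#)
      (+-mono (*-nonneg 0≤t p) (*-nonneg (≤⇒0≤ t≤1) p′)) ,
    ≤-respʳ (trans
        (sym (distribʳ (log (order G)) t (1# - t)))
        (trans (cong (_* log (order G)) (trans (+-comm t (1# - t)) (y-x+x≡y 1# t)))
          (*-identityˡ _)))
      (+-mono (*-monoˡ 0≤t q) (*-monoˡ (≤⇒0≤ t≤1) q′))

  values-bounded : ∀ G → 1 ℕ.≤ order G → ∀ x → InDomain G x → ∃ (UpperBound (Values G x))
  values-bounded G 1≤m x (0≤x , x≤L) with log (order G) ≤? 0#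
  ... | yes L≤0 = i G 1 1≤m , λ { _ (f , (_ , below) , refl) →
        ≤-respˡ (cong f (trans log1≡0 (antisym 0≤x (≤-trans x≤L L≤0))))
          (below 1 ℕ.≤-refl 1≤m) }
  ... | no L≰0 = _ , λ { _ (f , (convex , below) , refl) →
        ≤-respˡ (cong f x-eq) (≤-trans
          (convex L (log 1) t (log-nonneg (order G) , ≤-refl)
            (log-nonneg 1 , ≤-trans (≤-reflexive log1≡0) (log-nonneg (order G))) 0≤t t≤1)
          (+-mono (*-monoˡ 0≤t (below (order G) 1≤m ℕ.≤-refl))
                  (*-monoˡ (≤⇒0≤ t≤1) (below 1 ℕ.≤-refl 1≤m)))) }
    where
    L = log (order G)
    L≢0 : L ≢ 0#
    L≢0 eq = L≰0 (≤-reflexive eq)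
    0≤L⁻¹ = inv-nonneg (log-nonneg (order G)) L≢0
    L⁻¹*L = trans (*-comm (L ⁻¹) L) (*-inverseʳ L L≢0)
    t = L ⁻¹ * x
    0≤t : 0# ≤ t
    0≤t = *-nonneg 0≤L⁻¹ 0≤x
    t≤1 : t ≤ 1#
    t≤1 = ≤-respʳ L⁻¹*L (*-monoˡ 0≤L⁻¹ x≤L)
    x-eq : t * L + (1# - t) * log 1 ≡ x
    x-eq = begin
      t * L + (1# - t) * log 1  ≡⟨ cong (λ z → t * L + (1# - t) * z) log1≡0 ⟩
      t * L + (1# - t) * 0#     ≡⟨ cong (t * L +_) (zeroʳ _) ⟩
      t * L + 0#                ≡⟨ +-identityʳ _ ⟩
      L ⁻¹ * x * L              ≡⟨ xy∙z≈xz∙y (L ⁻¹) x L ⟩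
      L ⁻¹ * L * x              ≡⟨ cong (_* x) L⁻¹*L ⟩
      1# * x                    ≡⟨ *-identityˡ x ⟩
      x                         ∎
      where open ≡-Reasoning

  abstract
    convexMinorant : ∀ G → 1 ℕ.≤ order G → ∃ (IsConvexMinorant G)
    convexMinorant G 1≤m = ψ′ , (convex , below) , largest
      where
      inDomain? : U.Decidable (InDomain G)
      inDomain? x = (0# ≤? x) ×-dec (x ≤? log (order G))

      supremum : ∀ x → InDomain G x → ∃ (IsSupremum (Values G x))
      supremum x d = complete (Values G x) (0# , _ , zero-lowerBound G , refl)
                       (values-bounded G 1≤m x d)

      ψ′ : ℝ → ℝ
      ψ′ x with inDomain? x
      ... | yes d = proj₁ (supremum x d)
      ... | no  _ = 0#

      isSup : ∀ x → InDomain G x → IsSupremum (Values G x) (ψ′ x)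
      isSup x d with inDomain? x
      ... | yes d′ = proj₂ (supremum x d′)
      ... | no  ¬d = ⊥-elim (¬d d)

      largest : ∀ g → IsConvexLowerBound G g → ∀ x → InDomain G x → g x ≤ ψ′ x
      largest g lb x d = proj₁ (isSup x d) _ (g , lb , refl)

      convex : ConvexOn (InDomain G) ψ′
      convex x y t dx dy 0≤t t≤1 =
        proj₂ (isSup _ (convex-domain {G} dx dy 0≤t t≤1)) _ λ { _ (f , lb , refl) →
          ≤-trans (proj₁ lb x y t dx dy 0≤t t≤1)
            (+-mono (*-monoˡ 0≤t (largest f lb x dx))
                    (*-monoˡ (≤⇒0≤ t≤1) (largest f lb y dy))) }

      below : ∀ k → 1 ℕ.≤ k → (k≤m : k ℕ.≤ order G) → ψ′ (log k) ≤ i G k k≤m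
      below k 1≤k k≤m with inDomain? (log k)
      ... | yes d = proj₂ (proj₂ (supremum (log k) d)) _
                      λ { _ (f , lb , refl) → proj₂ lb k 1≤k k≤m }
      ... | no  _ = i-nonneg G k 1≤k k≤m

  -- For the graph without vertices [0 , log m] makes no sense, and ψ is junk.
  ψ : Graph → ℝ → ℝ
  ψ G with 1 ℕ.≤? order G
  ... | yes 1≤m = proj₁ (convexMinorant G 1≤m)
  ... | no  _   = λ _ → 0#

{-# OPTIONS --safe #-}

-- Let X be uniform on A, with N = |A|.  The edges of the product in direction j leaving A are counted fibre by fibre,
-- and a fibre B of A in that direction has at least |B| ψ_j(log |B|) of them.  By Jensen's inequality direction j thus
-- contributes at least N ψ_j(h_j), where h_j is the conditional entropy of X_j given the other coordinates, and these
-- entropies sum to at most H(X) = log N.  Here the factors are split off one at a time, so that the entropy inequality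
-- is only needed for two coordinates: if a planar set of N points has row sizes r and column sizes c, then
-- Σ r log r + Σ c log c ≤ N log N, which follows from log x ≤ x - 1 at the points x = r c / N.  As ψ_j is nonincreasing,
-- the h_j can be raised until their sum is log N.
--
-- The minimum over h is attained because each ψ_j is Lipschitz, a property inherited by infimal convolutions.
module Submission where

open import Defs
open import Data.Nat using (ℕ; NonZero)
open import Data.Fin using (Fin)
open import Data.Fin.Subset using (Subset; Nonempty; ∣_∣)
open import Data.Product using (∃; _×_)
open import Relation.Binary.PropositionalEquality using (_≡_)

open import Algebra.Bundles using (CommutativeRing)
import Algebra.Construct.NaturalChoice.Max
import Algebra.Construct.NaturalChoice.Min
import Algebra.Properties.Ring
import Algebra.Properties.Semiring.Mult
import Algebra.Properties.Semiring.Sum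
import Algebra.Solver.Ring.NaturalCoefficients.Default
open import Data.Empty using (⊥-elim)
open import Data.Fin as Fin using (zero; suc; combine; _↑ˡ_; _↑ʳ_)
import Data.Fin.Properties as Fin
open import Data.Fin.Subset using (inside; outside; _∈_; ⊤)
open import Data.Fin.Subset.Properties using (_∈?_; drop-there; ∈⊤; ∣⊤∣≡n; ∣p∣≤n; ∣p∣≤∣x∷p∣)
open import Data.List as List using (List; []; _∷_; length; filter; map; _++_; cartesianProduct)
import Data.List.Properties as List
import Data.List.Relation.Unary.All as All
open import Data.Nat as ℕ using (zero; suc; z≤n; s≤s)
open import Data.Nat.ListAction using () renaming (sum to listSum)
open import Data.Nat.ListAction.Properties using (sum-++)
import Data.Nat.Properties as ℕ
open import Data.Nat.Solver using (module +-*-Solver)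
open import Data.Product using (∃₂; _,_; proj₁; proj₂)
open import Data.Sum using (_⊎_; inj₁; inj₂)
open import Data.Vec using ([]; _∷_; tabulate; lookup; here; there)
open import Data.Vec.Properties using (lookup∘tabulate; []=⇒lookup; lookup⇒[]=)
import Data.Vec.Functional as F
open import Function using (_∘_; id)
open import Relation.Binary using (IsDecTotalOrder; Poset; TotalOrder; tri<; tri≈; tri>)
open import Relation.Binary.PropositionalEquality
  using (_≢_; refl; sym; trans; cong; cong₂; subst; subst₂; module ≡-Reasoning)
import Relation.Binary.Reasoning.PartialOrder
open import Relation.Nullary using (Dec; yes; no; ¬_)
open import Relation.Nullary.Decidable using (_×-dec_; ¬?)
import Relation.Unary as U

open Graph using (order; boundary; vertex; edges; exactlyOneIn?; Adj; adj?; adj-sym; adj-irrefl)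

-- The entropies are never defined as such. They arise as weighted means of logarithms of fibre
-- sizes, and a mean is any point z of the interval with W z = Σ w x, where W is the total weight.
-- The inequalities stay multiplied by the number of points, so that bounds for fibres add up
-- without division and an empty fibre just has weight 0.
--
-- The logarithm is known only as a supremum of lower sums of 1/t. Dilating and cutting partitions
-- yields log (r c) = log r + log c, and comparing heights of rectangles yields the tangent bound.
--
-- For the minimum, convexity alone gives no Lipschitz bound, because a convex function on a closed
-- interval may be arbitrarily steep, or even jump, at an end. At 0 the slope is controlled by the
-- maximality of ψ together with the gap between log 1 = 0 and log 2: no other log k lies in
-- between, so a line of finite slope starting at (0 , ψ 0) stays at or below all the points (log k
-- , i_k).

module ℕ∑ = Algebra.Properties.Semiring.Sum ℕ.+-*-semiring

-- Boundary edges as sums of indicators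

module Counting where

  open import Data.Nat using (_+_; _*_; _≤_)
  open ℕ∑ using (sum-syntax; ∑-comm; ∑-distrib-+; sum-cong-≗; sum-replicate-zero) renaming (sum to ∑)

  private variable
    m n : ℕ
    P Q : Set

  ⟦_⟧ : Dec P → ℕ
  ⟦ yes _ ⟧ = 1
  ⟦ no _  ⟧ = 0

  ⟦⟧-01 : ∀ {P : Set} (p? : Dec P) → ⟦ p? ⟧ ≡ 0 ⊎ ⟦ p? ⟧ ≡ 1
  ⟦⟧-01 (yes _) = inj₂ refl
  ⟦⟧-01 (no _)  = inj₁ refl

  ⟦⟧-cong : (P → Q) → (Q → P) → (p? : Dec P) (q? : Dec Q) → ⟦ p? ⟧ ≡ ⟦ q? ⟧
  ⟦⟧-cong f g (yes p) (yes q) = refl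
  ⟦⟧-cong f g (yes p) (no ¬q) = ⊥-elim (¬q (f p))
  ⟦⟧-cong f g (no ¬p) (yes q) = ⊥-elim (¬p (g q))
  ⟦⟧-cong f g (no ¬p) (no ¬q) = refl

  ⟦⟧-disjoint : ∀ {S T R : Set} (p? : Dec P) (q? : Dec Q) (s? : Dec S) (t? : Dec T) (r? : Dec R) →
    (P → Q → R) → (S → T → R) → (Q → ¬ S) → ⟦ p? ⟧ * ⟦ q? ⟧ + ⟦ s? ⟧ * ⟦ t? ⟧ ≤ ⟦ r? ⟧
  ⟦⟧-disjoint (yes p) (yes q) (yes s) _       _       _ _ k = ⊥-elim (k q s)
  ⟦⟧-disjoint (yes p) (yes q) (no _)  _       (yes _) _ _ _ = s≤s z≤n
  ⟦⟧-disjoint (yes p) (yes q) (no _)  _       (no ¬r) f _ _ = ⊥-elim (¬r (f p q))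
  ⟦⟧-disjoint (yes p) (no _)  (no _)  _       _       _ _ _ = z≤n
  ⟦⟧-disjoint (no _)  _       (no _)  _       _       _ _ _ = z≤n
  ⟦⟧-disjoint (yes p) (no _)  (yes s) (no _)  _       _ _ _ = z≤n
  ⟦⟧-disjoint (no _)  _       (yes s) (no _)  _       _ _ _ = z≤n
  ⟦⟧-disjoint (yes p) (no _)  (yes s) (yes t) (yes _) _ _ _ = s≤s z≤n
  ⟦⟧-disjoint (no _)  _       (yes s) (yes t) (yes _) _ _ _ = s≤s z≤n
  ⟦⟧-disjoint _       _       (yes s) (yes t) (no ¬r) _ g _ = ⊥-elim (¬r (g s t))

  ∑-mono : ∀ {f g : Fin n → ℕ} → (∀ i → f i ≤ g i) → ∑ f ≤ ∑ g
  ∑-mono {zero}  p = z≤n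
  ∑-mono {suc n} p = ℕ.+-mono-≤ (p zero) (∑-mono (p ∘ suc))

  ∑-↑ : ∀ m (f : Fin (m + n) → ℕ) → ∑ f ≡ ∑ (f ∘ (_↑ˡ n)) + ∑ (f ∘ (m ↑ʳ_))
  ∑-↑ zero    f = refl
  ∑-↑ (suc m) f = trans (cong (f zero +_) (∑-↑ m (f ∘ suc))) (sym (ℕ.+-assoc (f zero) _ _))

  ∑-combine : ∀ m (f : Fin (m * n) → ℕ) → ∑ f ≡ ∑[ i < m ] ∑[ j < n ] f (combine i j)
  ∑-combine         zero    f = refl
  ∑-combine {n = n} (suc m) f = trans (∑-↑ n f) (cong (∑ (f ∘ (_↑ˡ (m * n))) +_) (∑-combine m (f ∘ (n ↑ʳ_))))

  ∑-delta : ∀ (i : Fin n) (f : Fin n → ℕ) → ∑[ j < n ] (⟦ i Fin.≟ j ⟧ * f j) ≡ f i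
  ∑-delta {suc n} zero f = trans (cong₂ _+_ (ℕ.*-identityˡ _) (sum-replicate-zero n)) (ℕ.+-identityʳ _)
  ∑-delta {suc n} (suc i) f = trans (sum-cong-≗ (λ j → cong (_* f (suc j))
    (⟦⟧-cong Fin.suc-injective (cong suc) (suc i Fin.≟ suc j) (i Fin.≟ j)))) (∑-delta i (f ∘ suc))

  ∣∣≡∑ : ∀ (A : Subset n) → ∣ A ∣ ≡ ∑[ i < n ] ⟦ i ∈? A ⟧
  ∣∣≡∑ [] = refl
  ∣∣≡∑ (inside ∷ A)  = cong suc (trans (∣∣≡∑ A) (sum-cong-≗ λ i →
    ⟦⟧-cong there drop-there (i ∈? A) (suc i ∈? (inside ∷ A))))
  ∣∣≡∑ (outside ∷ A) = trans (∣∣≡∑ A) (sum-cong-≗ λ i →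
    ⟦⟧-cong there drop-there (i ∈? A) (suc i ∈? (outside ∷ A)))

  length-filter² : ∀ {X : Set} {P Q : X → Set} (P? : U.Decidable P) (Q? : U.Decidable Q) xs →
    length (filter Q? (filter P? xs)) ≡ listSum (map (λ x → ⟦ P? x ⟧ * ⟦ Q? x ⟧) xs)
  length-filter² P? Q? [] = refl
  length-filter² P? Q? (x ∷ xs) with P? x
  ... | no  _ = length-filter² P? Q? xs
  ... | yes _ with Q? x
  ...   | no  _ = length-filter² P? Q? xs
  ...   | yes _ = cong suc (length-filter² P? Q? xs)

  sum-tabulate : ∀ {X : Set} (g : Fin n → X) (f : X → ℕ) → listSum (map f (List.tabulate g)) ≡ ∑ (f ∘ g)
  sum-tabulate {zero}  g f = refl
  sum-tabulate {suc n} g f = cong (f (g zero) +_) (sum-tabulate (g ∘ suc) f)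

  sum-cartesianProduct : ∀ {X : Set} (g : Fin m → X) (f : X × Fin n → ℕ) →
    listSum (map f (cartesianProduct (List.tabulate g) (List.allFin n))) ≡ ∑[ i < m ] ∑[ j < n ] f (g i , j)
  sum-cartesianProduct {zero}      g f = refl
  sum-cartesianProduct {suc m} {n} g f = begin
    listSum (map f (map (g zero ,_) (List.allFin n) ++ rest))
      ≡⟨ cong listSum (List.map-++ f (map (g zero ,_) (List.allFin n)) rest) ⟩
    listSum (map f (map (g zero ,_) (List.allFin n)) ++ map f rest)
      ≡⟨ sum-++ (map f (map (g zero ,_) (List.allFin n))) _ ⟩
    listSum (map f (map (g zero ,_) (List.allFin n))) + listSum (map f rest)
      ≡⟨ cong₂ _+_ (trans (cong listSum (sym (List.map-∘ (List.allFin n)))) (sum-tabulate id (f ∘ (g zero ,_))))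
                   (sum-cartesianProduct (g ∘ suc) f) ⟩
    ∑ (λ j → f (g zero , j)) + ∑ (λ i → ∑ (λ j → f (g (suc i) , j))) ∎
    where
    open ≡-Reasoning
    rest = cartesianProduct (List.tabulate (g ∘ suc)) (List.allFin n)

  -- Every boundary edge has exactly one orientation that leaves `A`. Counting ordered pairs
  -- therefore removes the convention i < j of `edges`, and no order of indices has to be compared
  -- between a product and its factors.
  arc : ∀ (G : Graph) (A : Subset (order G)) (i j : Fin (order G)) → ℕ
  arc G A i j = ⟦ adj? G (vertex G i) (vertex G j) ⟧ * (⟦ i ∈? A ⟧ * ⟦ ¬? (j ∈? A) ⟧)

  boundary≡∑arc : ∀ G A → boundary G A ≡ ∑[ i < order G ] ∑[ j < order G ] arc G A i j
  boundary≡∑arc G A = begin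
    boundary G A
      ≡⟨ length-filter² _ (exactlyOneIn? G A) (cartesianProduct (List.allFin (order G)) (List.allFin (order G))) ⟩
    listSum (map _ (cartesianProduct (List.allFin (order G)) (List.allFin (order G))))
      ≡⟨ sum-cartesianProduct {order G} id (λ (i , j) →
           ⟦ (i Fin.<? j) ×-dec adj? G (vertex G i) (vertex G j) ⟧ * ⟦ exactlyOneIn? G A (i , j) ⟧) ⟩
    ∑ (λ i → ∑ (λ j → ⟦ (i Fin.<? j) ×-dec adj? G (vertex G i) (vertex G j) ⟧ * ⟦ exactlyOneIn? G A (i , j) ⟧))
      ≡⟨ sum-cong-≗ (λ i → trans (sum-cong-≗ (split i)) (∑-distrib-+ (fwd i) (bwd i))) ⟩
    ∑ (λ i → ∑ (fwd i) + ∑ (bwd i))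
      ≡⟨ ∑-distrib-+ (∑ ∘ fwd) (∑ ∘ bwd) ⟩
    ∑ (∑ ∘ fwd) + ∑ (∑ ∘ bwd)
      -- After the transposition the backward terms are the arcs from i to j with j < i, which
      -- complement the forward ones. The case i ≡ j is excluded in `merge` by irreflexivity.
      ≡⟨ cong (∑ (∑ ∘ fwd) +_) (∑-comm bwd) ⟩
    ∑ (∑ ∘ fwd) + ∑ (λ i → ∑ (λ j → bwd j i))
      ≡⟨ ∑-distrib-+ (∑ ∘ fwd) (λ i → ∑ (λ j → bwd j i)) ⟨
    ∑ (λ i → ∑ (fwd i) + ∑ (λ j → bwd j i))
      ≡⟨ sum-cong-≗ (λ i → trans (sym (∑-distrib-+ (fwd i) (λ j → bwd j i))) (sum-cong-≗ (merge i))) ⟩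
    ∑ (λ i → ∑ (λ j → arc G A i j)) ∎
    where
    open ≡-Reasoning

    fwd bwd : Fin (order G) → Fin (order G) → ℕ
    fwd i j = ⟦ i Fin.<? j ⟧ * arc G A i j
    bwd i j = ⟦ i Fin.<? j ⟧ * arc G A j i

    split : ∀ i j → ⟦ (i Fin.<? j) ×-dec adj? G (vertex G i) (vertex G j) ⟧ * ⟦ exactlyOneIn? G A (i , j) ⟧
                  ≡ ⟦ i Fin.<? j ⟧ * arc G A i j + ⟦ i Fin.<? j ⟧ * arc G A j i
    split i j rewrite ⟦⟧-cong (adj-sym G) (adj-sym G) (adj? G (vertex G j) (vertex G i)) (adj? G (vertex G i) (vertex G j))
      with i Fin.<? j | adj? G (vertex G i) (vertex G j) | i ∈? A | j ∈? A
    ... | no _  | _     | _     | _     = refl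
    ... | yes _ | no _  | _     | _     = refl
    ... | yes _ | yes _ | no _  | no _  = refl
    ... | yes _ | yes _ | no _  | yes _ = refl
    ... | yes _ | yes _ | yes _ | no _  = refl
    ... | yes _ | yes _ | yes _ | yes _ = refl

    merge : ∀ i j → ⟦ i Fin.<? j ⟧ * arc G A i j + ⟦ j Fin.<? i ⟧ * arc G A i j ≡ arc G A i j
    merge i j with adj? G (vertex G i) (vertex G j)
    ... | no _ rewrite ℕ.*-zeroʳ ⟦ i Fin.<? j ⟧ = ℕ.*-zeroʳ ⟦ j Fin.<? i ⟧
    ... | yes a with i Fin.<? j | j Fin.<? i
    ...   | yes _   | no _    = trans (ℕ.+-identityʳ _) (ℕ.*-identityˡ _)
    ...   | no _    | yes _   = ℕ.*-identityˡ _
    ...   | yes i<j | yes j<i = ⊥-elim (Fin.<-asym i<j j<i)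
    ...   | no i≮j  | no j≮i with Fin.<-cmp i j
    ...     | tri< i<j _ _ = ⊥-elim (i≮j i<j)
    ...     | tri> _ _ j<i = ⊥-elim (j≮i j<i)
    ...     | tri≈ _ i≡j _ = ⊥-elim (adj-irrefl G (cong (vertex G) i≡j) a)

  -- Fibres of a set in a product of two factors

  row : Subset (m * n) → Fin m → Subset n
  row A u = tabulate λ v → lookup A (combine u v)

  col : Subset (m * n) → Fin n → Subset m
  col A v = tabulate λ u → lookup A (combine u v)

  ∈-tabulate⁺ : ∀ {A : Subset m} {g : Fin n → Fin m} {k} → g k ∈ A → k ∈ tabulate (lookup A ∘ g)
  ∈-tabulate⁺ {A = A} {g} {k} p = lookup⇒[]= k _ (trans (lookup∘tabulate (lookup A ∘ g) k) ([]=⇒lookup p))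

  ∈-tabulate⁻ : ∀ {A : Subset m} {g : Fin n → Fin m} {k} → k ∈ tabulate (lookup A ∘ g) → g k ∈ A
  ∈-tabulate⁻ {A = A} {g} {k} p = lookup⇒[]= (g k) A (trans (sym (lookup∘tabulate (lookup A ∘ g) k)) ([]=⇒lookup p))

  ⟦∈-tabulate⟧ : ∀ (A : Subset m) (g : Fin n → Fin m) k → ⟦ g k ∈? A ⟧ ≡ ⟦ k ∈? tabulate (lookup A ∘ g) ⟧
  ⟦∈-tabulate⟧ A g k = ⟦⟧-cong ∈-tabulate⁺ ∈-tabulate⁻ (g k ∈? A) (k ∈? tabulate (lookup A ∘ g))

  ⟦∉-tabulate⟧ : ∀ (A : Subset m) (g : Fin n → Fin m) k → ⟦ ¬? (g k ∈? A) ⟧ ≡ ⟦ ¬? (k ∈? tabulate (lookup A ∘ g)) ⟧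
  ⟦∉-tabulate⟧ A g k = ⟦⟧-cong (_∘ ∈-tabulate⁻) (_∘ ∈-tabulate⁺) (¬? (g k ∈? A)) (¬? (k ∈? tabulate (lookup A ∘ g)))

  ∣row∣≡∑ : ∀ (A : Subset (m * n)) u → ∣ row {m} A u ∣ ≡ ∑[ v < n ] ⟦ combine u v ∈? A ⟧
  ∣row∣≡∑ {m} A u = trans (∣∣≡∑ (row {m} A u)) (sum-cong-≗ λ v → sym (⟦∈-tabulate⟧ A (combine u) v))

  ∣col∣≡∑ : ∀ (A : Subset (m * n)) v → ∣ col {m} A v ∣ ≡ ∑[ u < m ] ⟦ combine u v ∈? A ⟧
  ∣col∣≡∑ {m} A v = trans (∣∣≡∑ (col {m} A v)) (sum-cong-≗ λ u → sym (⟦∈-tabulate⟧ A (λ (w : Fin m) → combine w v) u))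

  ∣∣≡∑row : ∀ (A : Subset (m * n)) → ∣ A ∣ ≡ ∑[ u < m ] ∣ row {m} A u ∣
  ∣∣≡∑row {m} A = trans (∣∣≡∑ A) (trans (∑-combine m _) (sum-cong-≗ λ u → sym (∣row∣≡∑ {m} A u)))

  ∣∣≡∑col : ∀ (A : Subset (m * n)) → ∣ A ∣ ≡ ∑[ v < n ] ∣ col {m} A v ∣
  ∣∣≡∑col {m} {n} A = trans (∣∣≡∑ A) (trans (∑-combine m _)
    (trans (∑-comm {m} λ u v → ⟦ combine u v ∈? A ⟧) (sum-cong-≗ λ v → sym (∣col∣≡∑ {m} A v))))

  module _ {n} (Gs : Fin (suc n) → Graph) where

    private
      G H : Graph
      G = Gs zero
      H = □ (Gs ∘ suc)

    vertex-combine : ∀ u v → vertex (□ Gs) (combine u v) ≡ (vertex G u , vertex H v)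
    vertex-combine u v = cong (λ (a , b) → vertex G a , vertex H b) (Fin.remQuot-combine u v)

    -- The two products are never both 1: an edge of `G` changes the first coordinate, since `G` has
    -- no loops. An inequality is enough for a lower bound on the boundary, and it avoids recovering
    -- equality of tuples from equality of their components.
    adjacency-≤ : ∀ u v u′ v′ →
      ⟦ v Fin.≟ v′ ⟧ * ⟦ adj? G (vertex G u) (vertex G u′) ⟧ +
      ⟦ u Fin.≟ u′ ⟧ * ⟦ adj? H (vertex H v) (vertex H v′) ⟧
        ≤ ⟦ adj? (□ Gs) (vertex (□ Gs) (combine u v)) (vertex (□ Gs) (combine u′ v′)) ⟧
    adjacency-≤ u v u′ v′ = ⟦⟧-disjoint (v Fin.≟ v′) _ (u Fin.≟ u′) _ _
      (λ { refl a → lift (zero , a , λ { zero ne → ⊥-elim (ne refl) ; (suc l) _ → refl }) })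
      (λ { refl (j , a , eq) → lift (suc j , a , λ { zero _ → refl ; (suc l) ne → eq l (ne ∘ cong suc) }) })
      (λ { a refl → adj-irrefl G refl a })
      where
      lift : Adj (□ Gs) (vertex G u , vertex H v) (vertex G u′ , vertex H v′) →
             Adj (□ Gs) (vertex (□ Gs) (combine u v)) (vertex (□ Gs) (combine u′ v′))
      lift = subst₂ (Adj (□ Gs)) (sym (vertex-combine u v)) (sym (vertex-combine u′ v′))

    module _ (A : Subset (order (□ Gs))) where

      private
        o : Fin (order G) → Fin (order H) → Fin (order G) → Fin (order H) → ℕ
        o u v u′ v′ = ⟦ combine u v ∈? A ⟧ * ⟦ ¬? (combine u′ v′ ∈? A) ⟧

        adjG : Fin (order G) → Fin (order G) → ℕ
        adjG u u′ = ⟦ adj? G (vertex G u) (vertex G u′) ⟧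

        adjH : Fin (order H) → Fin (order H) → ℕ
        adjH v v′ = ⟦ adj? H (vertex H v) (vertex H v′) ⟧

      arcs-≤ : ∀ u v →
        ∑[ u′ < order G ] arc G (col {order G} A v) u u′ + ∑[ v′ < order H ] arc H (row {order G} A u) v v′
          ≤ ∑[ u′ < order G ] ∑[ v′ < order H ] arc (□ Gs) A (combine u v) (combine u′ v′)
      arcs-≤ u v = begin
        ∑ (λ u′ → arc G (col {order G} A v) u u′) + ∑ (λ v′ → arc H (row {order G} A u) v v′)
          ≡⟨ cong₂ _+_
               (sum-cong-≗ (λ u′ → sym (cong (adjG u u′ *_) (cong₂ _*_
                 (⟦∈-tabulate⟧ A (λ w → combine w v) u) (⟦∉-tabulate⟧ A (λ w → combine w v) u′)))))
               (sum-cong-≗ (λ v′ → sym (cong (adjH v v′ *_) (cong₂ _*_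
                 (⟦∈-tabulate⟧ A (combine u) v) (⟦∉-tabulate⟧ A (combine u) v′))))) ⟩
        ∑ (λ u′ → adjG u u′ * o u v u′ v) + ∑ (λ v′ → adjH v v′ * o u v u v′)
          -- A Kronecker delta restores the missing summation variable, so that both kinds of arcs
          -- are summed over the same pairs (u′ , v′).
          ≡⟨ cong₂ _+_
               (sum-cong-≗ (λ u′ → ∑-delta v (λ v′ → adjG u u′ * o u v u′ v′)))
               (trans (∑-comm (λ u′ v′ → ⟦ u Fin.≟ u′ ⟧ * (adjH v v′ * o u v u′ v′)))
                 (sum-cong-≗ (λ v′ → ∑-delta u (λ u′ → adjH v v′ * o u v u′ v′)))) ⟨
        ∑ (λ u′ → ∑ (λ v′ → ⟦ v Fin.≟ v′ ⟧ * (adjG u u′ * o u v u′ v′))) +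
        ∑ (λ u′ → ∑ (λ v′ → ⟦ u Fin.≟ u′ ⟧ * (adjH v v′ * o u v u′ v′)))
          ≡⟨ trans (sum-cong-≗ λ u′ → ∑-distrib-+ (λ v′ → ⟦ v Fin.≟ v′ ⟧ * (adjG u u′ * o u v u′ v′)) _)
               (∑-distrib-+ (λ u′ → ∑ (λ v′ → ⟦ v Fin.≟ v′ ⟧ * (adjG u u′ * o u v u′ v′))) _) ⟨
        ∑ (λ u′ → ∑ (λ v′ → ⟦ v Fin.≟ v′ ⟧ * (adjG u u′ * o u v u′ v′)
                          + ⟦ u Fin.≟ u′ ⟧ * (adjH v v′ * o u v u′ v′)))
          ≤⟨ ∑-mono (λ u′ → ∑-mono λ v′ → ℕ.≤-trans
               (ℕ.≤-reflexive (solve 5 (λ a b c d e → a :* (b :* e) :+ c :* (d :* e) := (a :* b :+ c :* d) :* e) refl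
                 ⟦ v Fin.≟ v′ ⟧ (adjG u u′) ⟦ u Fin.≟ u′ ⟧ (adjH v v′) (o u v u′ v′)))
               (ℕ.*-monoˡ-≤ (o u v u′ v′) (adjacency-≤ u v u′ v′))) ⟩
        ∑[ u′ < order G ] ∑[ v′ < order H ] arc (□ Gs) A (combine u v) (combine u′ v′) ∎
        where
        open ℕ.≤-Reasoning
        open +-*-Solver using (solve; _:+_; _:*_; _:=_)

      boundary-□ : ∑[ v < order H ] boundary G (col {order G} A v) + ∑[ u < order G ] boundary H (row {order G} A u)
                     ≤ boundary (□ Gs) A
      boundary-□ = begin
        ∑ (λ v → boundary G (col {order G} A v)) + ∑ (λ u → boundary H (row {order G} A u))
          ≡⟨ cong₂ _+_ (sum-cong-≗ λ v → boundary≡∑arc G (col {order G} A v))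
                       (sum-cong-≗ λ u → boundary≡∑arc H (row {order G} A u)) ⟩
        ∑ (λ v → ∑ λ u → ∑ λ u′ → arc G (col {order G} A v) u u′) +
        ∑ (λ u → ∑ λ v → ∑ λ v′ → arc H (row {order G} A u) v v′)
          ≡⟨ cong (_+ ∑ (λ u → ∑ λ v → ∑ λ v′ → arc H (row {order G} A u) v v′))
               (∑-comm (λ v u → ∑ λ u′ → arc G (col {order G} A v) u u′)) ⟩
        ∑ (λ u → ∑ λ v → ∑ λ u′ → arc G (col {order G} A v) u u′) +
        ∑ (λ u → ∑ λ v → ∑ λ v′ → arc H (row {order G} A u) v v′)
          ≡⟨ trans (sum-cong-≗ λ u → ∑-distrib-+ (λ v → ∑ λ u′ → arc G (col {order G} A v) u u′) _)
               (∑-distrib-+ (λ u → ∑ λ v → ∑ λ u′ → arc G (col {order G} A v) u u′) _) ⟨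
        ∑ (λ u → ∑ λ v → ∑ (λ u′ → arc G (col {order G} A v) u u′) + ∑ (λ v′ → arc H (row {order G} A u) v v′))
          ≤⟨ ∑-mono (λ u → ∑-mono (arcs-≤ u)) ⟩
        ∑[ u < order G ] ∑[ v < order H ] ∑[ u′ < order G ] ∑[ v′ < order H ] arc (□ Gs) A (combine u v) (combine u′ v′)
          ≡⟨ sum-cong-≗ {order G} (λ u → sum-cong-≗ {order H} λ v → ∑-combine {order H} (order G) (arc (□ Gs) A (combine u v))) ⟨
        ∑[ u < order G ] ∑[ v < order H ] ∑ (arc (□ Gs) A (combine u v))
          ≡⟨ ∑-combine {order H} (order G) (λ k → ∑ (arc (□ Gs) A k)) ⟨
        ∑ (λ k → ∑ (arc (□ Gs) A k))
          ≡⟨ boundary≡∑arc (□ Gs) A ⟨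
        boundary (□ Gs) A ∎
        where open ℕ.≤-Reasoning

  boundary-⊤ : ∀ G → boundary G ⊤ ≡ 0
  boundary-⊤ G = cong length (List.filter-none (exactlyOneIn? G ⊤)
    (All.universal (λ { _ (inj₁ (_ , j∉⊤)) → j∉⊤ ∈⊤ ; _ (inj₂ (i∉⊤ , _)) → i∉⊤ ∈⊤ }) (edges G)))

  nonempty-∣∣ : ∀ {n} {A : Subset n} {k} → k ∈ A → 1 ≤ ∣ A ∣
  nonempty-∣∣ here                          = s≤s z≤n
  nonempty-∣∣ {A = x ∷ A} (there k∈A) = ℕ.≤-trans (nonempty-∣∣ k∈A) (∣p∣≤∣x∷p∣ x A)

  -- The digits of an index of the product are indices of the factors. A nonempty set supplies such
  -- an index, so every ψ in the theorem is a true convex minorant and not the junk value of the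
  -- graph without vertices.
  orders-positive : ∀ {n} (Gs : Fin n → Graph) → Fin (tupleCount Gs) → ∀ j → 1 ≤ order (Gs j)
  orders-positive Gs k zero    = ℕ.≤-trans (s≤s z≤n) (Fin.toℕ<n (Fin.quotient {order (Gs zero)} _ k))
  orders-positive Gs k (suc j) = orders-positive (Gs ∘ suc) (Fin.remainder {order (Gs zero)} _ k) j

open Counting

module Proof (reals : CompleteOrderedField) where

  open Analysis reals
  open CommutativeRing commutativeRing
    using (+-identityˡ; +-identityʳ; *-identityˡ; *-identityʳ; *-assoc; *-comm; +-assoc; +-comm
          ; distribˡ; distribʳ; zeroˡ; zeroʳ; -‿inverseʳ; semiring; commutativeSemiring; ring)
  open IsDecTotalOrder isDecTotalOrder
    using (_≤?_; _≟_; total; antisym)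
    renaming (refl to ≤-refl; trans to ≤-trans; reflexive to ≤-reflexive)
  open Algebra.Properties.Ring ring using (+-cancelˡ)
  open Algebra.Properties.Semiring.Mult semiring using (×-homo-+; ×1-homo-*)
  open Algebra.Properties.Semiring.Sum semiring
    using (sum-cong-≗; ∑-distrib-+; ∑-comm; *-distribˡ-sum; *-distribʳ-sum; sum-replicate; sum-replicate-zero)
  open Algebra.Solver.Ring.NaturalCoefficients.Default commutativeSemiring
    using (solve; _:+_; _:*_; _:=_; con)

  -- Order and arithmetic of the real field

  private
    poset : Poset _ _ _
    poset = record { isPartialOrder = IsDecTotalOrder.isPartialOrder isDecTotalOrder }

    totalOrder : TotalOrder _ _ _
    totalOrder = record { isTotalOrder = IsDecTotalOrder.isTotalOrder isDecTotalOrder }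

  module ≤-Reasoning = Relation.Binary.Reasoning.PartialOrder poset

  open Algebra.Construct.NaturalChoice.Max totalOrder using (_⊔_; x≤x⊔y; x≤y⊔x; ⊔-lub)
  open Algebra.Construct.NaturalChoice.Min totalOrder using (_⊓_; x⊓y≤x; x⊓y≤y; ⊓-glb; ⊓-sel)

  -- The solver handles commutative semirings, so an inequality is turned into an equation with an
  -- explicit nonnegative difference instead of a subtraction.
  gap : ∀ {x y} → x ≤ y → ∃ λ d → 0# ≤ d × y ≡ x + d
  gap {x} {y} p = y - x , ≤⇒0≤ p , sym (trans (+-comm x _) (y-x+x≡y y x))

  x≤x+d : ∀ {x d} → 0# ≤ d → x ≤ x + d
  x≤x+d {x} p = ≤-respˡ (+-identityʳ x) (+-mono ≤-refl p)

  +-cancelˡ-≤ : ∀ a {x y} → a + x ≤ a + y → x ≤ y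
  +-cancelˡ-≤ a {x} {y} p with total x y
  ... | inj₁ q = q
  ... | inj₂ q = ≤-reflexive (+-cancelˡ a x y (antisym p (+-mono ≤-refl q)))

  *-monoʳ : ∀ {a x y} → 0# ≤ a → x ≤ y → x * a ≤ y * a
  *-monoʳ {a} {x} {y} p q = subst₂ _≤_ (*-comm a x) (*-comm a y) (*-monoˡ p q)

  x⁻¹*[x*y] : ∀ {x} y → x ≢ 0# → x ⁻¹ * (x * y) ≡ y
  x⁻¹*[x*y] {x} y x≢0 = trans (sym (*-assoc (x ⁻¹) x y))
    (trans (cong (_* y) (trans (*-comm (x ⁻¹) x) (*-inverseʳ x x≢0))) (*-identityˡ y))

  x*[x⁻¹*y] : ∀ {x} y → x ≢ 0# → x * (x ⁻¹ * y) ≡ y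
  x*[x⁻¹*y] {x} y x≢0 = trans (sym (*-assoc x (x ⁻¹) y))
    (trans (cong (_* y) (*-inverseʳ x x≢0)) (*-identityˡ y))

  Positive : ℝ → Set
  Positive x = 0# ≤ x × x ≢ 0#

  *-cancelˡ-≤ : ∀ {a x y} → Positive a → a * x ≤ a * y → x ≤ y
  *-cancelˡ-≤ {a} {x} {y} (0≤a , a≢0) p =
    subst₂ _≤_ (x⁻¹*[x*y] x a≢0) (x⁻¹*[x*y] y a≢0) (*-monoˡ (inv-nonneg 0≤a a≢0) p)

  *-cancelˡ-≡ : ∀ {a x y} → a ≢ 0# → a * x ≡ a * y → x ≡ y
  *-cancelˡ-≡ {a} {x} {y} a≢0 p = trans (sym (x⁻¹*[x*y] x a≢0)) (trans (cong (a ⁻¹ *_) p) (x⁻¹*[x*y] y a≢0))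

  positive-* : ∀ {x y} → Positive x → Positive y → Positive (x * y)
  positive-* {x} {y} (0≤x , x≢0) (0≤y , y≢0) = *-nonneg 0≤x 0≤y , λ eq →
    y≢0 (*-cancelˡ-≡ x≢0 (trans eq (sym (zeroʳ x))))

  positive-⁻¹ : ∀ {x} → Positive x → Positive (x ⁻¹)
  positive-⁻¹ {x} (0≤x , x≢0) = inv-nonneg 0≤x x≢0 , λ eq →
    0≢1 (trans (sym (zeroʳ x)) (trans (cong (x *_) (sym eq)) (*-inverseʳ x x≢0)))

  positive-≤ : ∀ {x y} → Positive x → x ≤ y → Positive y
  positive-≤ (0≤x , x≢0) p = ≤-trans 0≤x p , λ { refl → x≢0 (antisym p 0≤x) }

  positive-1 : Positive 1#
  positive-1 = 0≤1 , 0≢1 ∘ sym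

  positive-fromℕ : ∀ k → Positive (fromℕ (suc k))
  positive-fromℕ k = positive-≤ positive-1 (1≤fromℕ k)

  0≤+ : ∀ {x y} → 0# ≤ x → 0# ≤ y → 0# ≤ x + y
  0≤+ p q = ≤-respˡ (+-identityʳ 0#) (+-mono p q)

  nonneg-sum≡0 : ∀ {x y} → 0# ≤ x → 0# ≤ y → x + y ≡ 0# → x ≡ 0#
  nonneg-sum≡0 {x} {y} p q eq = antisym (≤-respʳ eq (x≤x+d q)) p

  ≰⇒≥ : ∀ {x y} → ¬ (x ≤ y) → y ≤ x
  ≰⇒≥ {x} {y} x≰y with total x y
  ... | inj₁ p = ⊥-elim (x≰y p)
  ... | inj₂ p = p

  fromℕ-+ : ∀ m n → fromℕ (m ℕ.+ n) ≡ fromℕ m + fromℕ n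
  fromℕ-+ = ×-homo-+ 1#

  fromℕ-* : ∀ m n → fromℕ (m ℕ.* n) ≡ fromℕ m * fromℕ n
  fromℕ-* = ×1-homo-*

  fromℕ-mono : ∀ {m n} → m ℕ.≤ n → fromℕ m ≤ fromℕ n
  fromℕ-mono {n = n} z≤n     = fromℕ-nonneg n
  fromℕ-mono (s≤s p) = +-mono ≤-refl (fromℕ-mono p)

  fromℕ-sum : ∀ {n} (f : Fin n → ℕ) → fromℕ (ℕ∑.sum f) ≡ sum (fromℕ ∘ f)
  fromℕ-sum {zero}  f = refl
  fromℕ-sum {suc n} f = trans (fromℕ-+ (f zero) _) (cong (fromℕ (f zero) +_) (fromℕ-sum (f ∘ suc)))

  sum-mono : ∀ {n} {f g : Fin n → ℝ} → (∀ j → f j ≤ g j) → sum f ≤ sum g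
  sum-mono {zero}  p = ≤-refl
  sum-mono {suc n} p = +-mono (p zero) (sum-mono (p ∘ suc))

  sum-nonneg : ∀ {n} {f : Fin n → ℝ} → (∀ j → 0# ≤ f j) → 0# ≤ sum f
  sum-nonneg {zero}  p = ≤-refl
  sum-nonneg {suc n} p = 0≤+ (p zero) (sum-nonneg (p ∘ suc))

  -- Lower sums of 1/t and the logarithm

  slab : ℝ → ℝ → ℝ
  slab a c = (c - a) * c ⁻¹

  -- The form of the definition without subtraction or inverse, in which the solver can work with
  -- the rectangle of height 1/c over [a , c]; `slab-unique` is the converse.
  slab-* : ∀ {a c} → c ≢ 0# → slab a c * c + a ≡ c
  slab-* {a} {c} c≢0 = trans (cong (_+ a) (trans (*-assoc (c - a) (c ⁻¹) c)
    (trans (cong ((c - a) *_) (trans (*-comm (c ⁻¹) c) (*-inverseʳ c c≢0))) (*-identityʳ _)))) (y-x+x≡y c a)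

  slab-nonneg : ∀ {a c} → Positive a → a ≤ c → 0# ≤ slab a c
  slab-nonneg p a≤c = *-nonneg (≤⇒0≤ a≤c) (proj₁ (positive-⁻¹ (positive-≤ p a≤c)))

  slab-unique : ∀ {a c s} → c ≢ 0# → s * c + a ≡ c → s ≡ slab a c
  slab-unique {a} {c} {s} c≢0 eq = *-cancelˡ-≡ c≢0 (+-cancelˡ a _ _ (begin
    a + c * s          ≡⟨ solve 3 (λ a c s → a :+ c :* s := s :* c :+ a) refl a c s ⟩
    s * c + a          ≡⟨ trans eq (sym (slab-* c≢0)) ⟩
    slab a c * c + a   ≡⟨ solve 3 (λ a c s → s :* c :+ a := a :+ c :* s) refl a c (slab a c) ⟩
    a + c * slab a c   ∎))
    where open ≡-Reasoning

  lowerSum-nonneg : ∀ {a b s} → Positive a → LowerSum a b s → 0# ≤ s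
  lowerSum-nonneg p []       = ≤-refl
  lowerSum-nonneg p (q ∷ ss) = 0≤+ (slab-nonneg p q) (lowerSum-nonneg (positive-≤ p q) ss)

  lowerSum-++ : ∀ {a b c s t} → LowerSum a b s → LowerSum b c t → LowerSum a c (s + t)
  lowerSum-++ []       ts = subst (LowerSum _ _) (sym (+-identityˡ _)) ts
  lowerSum-++ (q ∷ ss) ts = subst (LowerSum _ _) (sym (+-assoc _ _ _)) (q ∷ lowerSum-++ ss ts)

  -- Invariance of dt/t under dilation: a slab depends only on the ratio of its endpoints.
  lowerSum-scale : ∀ {k a b s} → Positive k → Positive a → LowerSum a b s → LowerSum (k * a) (k * b) s
  lowerSum-scale pk pa [] = []
  lowerSum-scale {k} {a} {b} pk pa (_∷_ {c = c} {s = s} q ss) =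
    subst (LowerSum (k * a) (k * b)) (cong (_+ s) (sym slab-scale))
      (*-monoˡ (proj₁ pk) q ∷ lowerSum-scale pk pc ss)
    where
    pc = positive-≤ pa q
    slab-scale : slab a c ≡ slab (k * a) (k * c)
    slab-scale = slab-unique (proj₂ (positive-* pk pc)) (begin
      slab a c * (k * c) + k * a
        ≡⟨ solve 4 (λ s k c a → s :* (k :* c) :+ k :* a := k :* (s :* c :+ a)) refl (slab a c) k c a ⟩
      k * (slab a c * c + a)      ≡⟨ cong (k *_) (slab-* (proj₂ pc)) ⟩
      k * c                       ∎)
      where open ≡-Reasoning

  -- As 1/t ≤ 1/a on [a , b], the sum is at most (b - a)/a; the denominator is cleared.
  lowerSum-≤ : ∀ {a b s} → Positive a → LowerSum a b s → s * a + a ≤ b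
  lowerSum-≤ {a} p [] = ≤-reflexive (trans (cong (_+ a) (zeroˡ a)) (+-identityˡ a))
  lowerSum-≤ {a} {b} p (_∷_ {c = c} {s = s} q ss) = begin
    (slab a c + s) * a + a        ≈⟨ solve 3 (λ a q s → (q :+ s) :* a :+ a := q :* a :+ s :* a :+ a) refl a (slab a c) s ⟩
    slab a c * a + s * a + a
      ≤⟨ +-mono (+-mono (*-monoˡ (slab-nonneg p q) q) (*-monoˡ (lowerSum-nonneg pc ss) q)) ≤-refl ⟩
    slab a c * c + s * c + a      ≈⟨ solve 3 (λ x y a → x :+ y :+ a := y :+ (x :+ a)) refl (slab a c * c) (s * c) a ⟩
    s * c + (slab a c * c + a)    ≈⟨ cong (s * c +_) (slab-* (proj₂ pc)) ⟩
    s * c + c                     ≤⟨ lowerSum-≤ pc ss ⟩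
    b                             ∎
    where
    open ≤-Reasoning
    pc = positive-≤ p q

  -- Inserting the point x into the partition can only raise the lower sum, since the rectangle over
  -- [a , x] grows from height 1/c to 1/x.
  lowerSum-split : ∀ {a b s x} → Positive a → a ≤ x → x ≤ b → LowerSum a b s →
                   ∃₂ λ s₁ s₂ → LowerSum a x s₁ × LowerSum x b s₂ × s ≤ s₁ + s₂
  lowerSum-split p a≤x x≤b [] with refl ← antisym a≤x x≤b =
    0# , 0# , [] , [] , ≤-reflexive (sym (+-identityˡ 0#))
  lowerSum-split {a} {x = x} p a≤x x≤b (_∷_ {c = c} {s = s} q ss) with total x c
  ... | inj₁ x≤c = _ , _ , a≤x ∷ [] , x≤c ∷ ss ,
        ≤-respʳ (solve 3 (λ u v s → u :+ v :+ s := u :+ con 0 :+ (v :+ s)) refl (slab a x) (slab x c) s)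
          (+-mono refine ≤-refl)
    where
    px = positive-≤ p a≤x
    pc = positive-≤ p q
    refine : slab a c ≤ slab a x + slab x c
    refine = *-cancelˡ-≤ pc (+-cancelˡ-≤ a (begin
      a + c * slab a c                           ≈⟨ solve 3 (λ a c s → a :+ c :* s := s :* c :+ a) refl a c (slab a c) ⟩
      slab a c * c + a                           ≈⟨ trans (slab-* (proj₂ pc)) (sym (slab-* (proj₂ pc))) ⟩
      slab x c * c + x                           ≈⟨ cong (slab x c * c +_) (sym (slab-* (proj₂ px))) ⟩
      slab x c * c + (slab a x * x + a)          ≤⟨ +-mono ≤-refl (+-mono (*-monoˡ (slab-nonneg p a≤x) x≤c) ≤-refl) ⟩
      slab x c * c + (slab a x * c + a)
        ≈⟨ solve 4 (λ a c u v → u :* c :+ (v :* c :+ a) := a :+ c :* (v :+ u)) refl a c (slab x c) (slab a x) ⟩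
      a + c * (slab a x + slab x c)              ∎))
      where open ≤-Reasoning
  ... | inj₂ c≤x with s₁ , s₂ , ss₁ , ss₂ , le ← lowerSum-split (positive-≤ p q) c≤x x≤b ss =
        _ , s₂ , q ∷ ss₁ , ss₂ , ≤-trans (+-mono ≤-refl le) (≤-reflexive (sym (+-assoc _ s₁ s₂)))

  -- The suprema are bounded one after the other: for fixed t the first is at most u - t, hence
  -- every t is at most u minus the first supremum.
  sup-+ : ∀ {S T : ℝ → Set} {x y u} → IsSupremum S x → IsSupremum T y →
          (∀ s t → S s → T t → s + t ≤ u) → x + y ≤ u
  sup-+ {x = x} {y} {u} (_ , x-least) (_ , y-least) h = move (y-least _ λ t Tt → unmove
    (≤-respˡ (+-comm t x) (move (x-least _ λ s Ss → unmove (≤-respˡ (+-comm s t) (h s t Ss Tt))))))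
    where
    move : ∀ {a b} → b ≤ u - a → a + b ≤ u
    move {a} {b} p = subst₂ _≤_ (+-comm b a) (y-x+x≡y u a) (+-monoˡ-≤ a p)
    unmove : ∀ {a b} → a + b ≤ u → b ≤ u - a
    unmove {a} {b} p = +-cancelˡ-≤ a (≤-respʳ (sym (trans (+-comm a _) (y-x+x≡y u a))) p)

  log-isSupremum : ∀ k → IsSupremum (LowerSum 1# (fromℕ (suc k))) (log (suc k))
  log-isSupremum k = proj₂ (∫₁1/t (fromℕ (suc k)) (1≤fromℕ k))

  -- Appending a partition of [1 , B] dilated by A to one of [1 , A] gives one inequality. Cutting a
  -- partition of [1 , A B] at A and dilating its right part back gives the other.
  log-* : ∀ a b → log (suc a ℕ.* suc b) ≡ log (suc a) + log (suc b)
  log-* a b = antisym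
    (proj₂ (log-isSupremum ab) _ λ s ss → upper (subst (λ z → LowerSum 1# z s) AB ss))
    (sup-+ (log-isSupremum a) (log-isSupremum b) λ s t ss ts →
      proj₁ (log-isSupremum ab) _ (subst (λ z → LowerSum 1# z (s + t)) (sym AB)
        (lowerSum-++ ss (subst (λ z → LowerSum z (A * B) t) (*-identityʳ A) (lowerSum-scale pA positive-1 ts)))))
    where
    ab = b ℕ.+ a ℕ.* suc b
    A = fromℕ (suc a)
    B = fromℕ (suc b)
    pA = positive-fromℕ a
    AB : fromℕ (suc a ℕ.* suc b) ≡ A * B
    AB = fromℕ-* (suc a) (suc b)
    upper : ∀ {s} → LowerSum 1# (A * B) s → s ≤ log (suc a) + log (suc b)
    upper ss with s₁ , s₂ , ss₁ , ss₂ , le ← lowerSum-split positive-1 (1≤fromℕ a)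
                      (≤-respˡ (*-identityʳ A) (*-monoˡ (proj₁ pA) (1≤fromℕ b))) ss =
      ≤-trans le (+-mono (proj₁ (log-isSupremum a) _ ss₁) (proj₁ (log-isSupremum b) _
        (subst₂ (λ y z → LowerSum y z s₂) (trans (*-comm (A ⁻¹) A) (*-inverseʳ A (proj₂ pA))) (x⁻¹*[x*y] B (proj₂ pA))
          (lowerSum-scale (positive-⁻¹ pA) pA ss₂))))

  log-slab : ∀ {m n} → m ℕ.≤ n → log (suc m) + slab (fromℕ (suc m)) (fromℕ (suc n)) ≤ log (suc n)
  -- The second set is a singleton, so `sup-+` adds one further rectangle to every lower sum.
  log-slab {m} {n} m≤n = sup-+ {T = _≡ slab (fromℕ (suc m)) (fromℕ (suc n))} (log-isSupremum m)
    ((λ _ → λ { refl → ≤-refl }) , λ _ ub → ub _ refl)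
    λ s _ ss → λ { refl → proj₁ (log-isSupremum n) _ (lowerSum-++ ss
      (subst (LowerSum _ _) (+-identityʳ _) (fromℕ-mono (s≤s m≤n) ∷ []))) }

  log-mono : ∀ {m n} → m ℕ.≤ n → log m ≤ log n
  log-mono {n = n} z≤n     = log-nonneg n
  log-mono         (s≤s {m} p) = ≤-trans (x≤x+d (slab-nonneg (positive-fromℕ m) (fromℕ-mono (s≤s p)))) (log-slab p)

  -- log (M / N) ≤ M / N - 1, multiplied by N and free of subtraction.
  log-tangent : ∀ m n → let M = fromℕ (suc m); N = fromℕ (suc n) in
                N * log (suc m) + N ≤ M + N * log (suc n)
  log-tangent m n with ℕ.≤-total m n
  -- For M ≤ N the claim is 1 - M/N ≤ log N - log M, and its left side is `slab M N`.
  ... | inj₁ m≤n = begin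
    N * log (suc m) + N                         ≈⟨ cong (N * log (suc m) +_) (slab-* (proj₂ pN)) ⟨
    N * log (suc m) + (slab M N * N + M)
      ≈⟨ solve 4 (λ n l s m → n :* l :+ (s :* n :+ m) := m :+ n :* (l :+ s)) refl N (log (suc m)) (slab M N) M ⟩
    M + N * (log (suc m) + slab M N)            ≤⟨ +-mono ≤-refl (*-monoˡ (proj₁ pN) (log-slab m≤n)) ⟩
    M + N * log (suc n)                         ∎
    where
    open ≤-Reasoning
    M = fromℕ (suc m)
    N = fromℕ (suc n)
    pN = positive-fromℕ n
  -- For N ≤ M the integral of 1/t over [N , M] is bounded from above by `d`, the length of the
  -- interval times its greatest height 1/N.
  ... | inj₂ n≤m = begin
    N * log (suc m) + N              ≤⟨ +-mono (*-monoˡ (proj₁ pN) bound) ≤-refl ⟩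
    N * (log (suc n) + d) + N
      ≈⟨ solve 3 (λ n l d → n :* (l :+ d) :+ n := n :* d :+ n :+ n :* l) refl N (log (suc n)) d ⟩
    N * d + N + N * log (suc n)      ≈⟨ cong (_+ N * log (suc n)) N*d+N ⟩
    M + N * log (suc n)              ∎
    where
    open ≤-Reasoning
    M = fromℕ (suc m)
    N = fromℕ (suc n)
    pN = positive-fromℕ n
    d = N ⁻¹ * (M - N)
    N*d+N : N * d + N ≡ M
    N*d+N = trans (cong (_+ N) (x*[x⁻¹*y] (M - N) (proj₂ pN))) (y-x+x≡y M N)
    bound : log (suc m) ≤ log (suc n) + d
    bound = proj₂ (log-isSupremum m) _ λ s ss →
      let s₁ , s₂ , ss₁ , ss₂ , le = lowerSum-split positive-1 (1≤fromℕ n) (fromℕ-mono (s≤s n≤m)) ss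
      in ≤-trans le (+-mono (proj₁ (log-isSupremum n) _ ss₁)
           (*-cancelˡ-≤ pN (+-cancelˡ-≤ N (subst₂ _≤_
             (solve 2 (λ s n → s :* n :+ n := n :+ n :* s) refl s₂ N)
             (trans (sym N*d+N) (+-comm _ N)) (lowerSum-≤ pN ss₂)))))

  -- If log 2 were 0, the tangent bound at M = 1, N = 2 would read 2 ≤ 1.
  log2-positive : Positive (log 2)
  log2-positive = log-nonneg 2 , λ log2≡0 → 0≢1 (antisym 0≤1
    (+-cancelˡ-≤ 1# (+-cancelˡ-≤ 0# (subst₂ _≤_
      (trans (cong₂ (λ l t → t * l + t) log1≡0 refl)
        (solve 1 (λ u → (u :+ (u :+ con 0)) :* con 0 :+ (u :+ (u :+ con 0)) := con 0 :+ (u :+ u)) refl 1#))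
      (trans (cong (λ l → fromℕ 1 + fromℕ 2 * l) log2≡0)
        (solve 1 (λ u → u :+ con 0 :+ (u :+ (u :+ con 0)) :* con 0 := con 0 :+ (u :+ con 0)) refl 1#))
      (log-tangent 0 1)))))

  -- The entropy inequality for two coordinates

  entropy-term : ∀ k {a} r c → a ≡ 0 ⊎ (a ≡ 1 × 1 ℕ.≤ r × 1 ℕ.≤ c) → let N = fromℕ (suc k) in
    fromℕ a * (N * (log r + log c) + N) ≤ fromℕ r * fromℕ c + fromℕ a * (N * log (suc k))
  -- Points outside the set still contribute r c on the right: only over the whole grid do these
  -- products add up to N².
  entropy-term k r c (inj₁ refl) = subst₂ _≤_ (sym (zeroˡ _))
    (sym (trans (cong (fromℕ r * fromℕ c +_) (zeroˡ _)) (+-identityʳ _)))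
    (*-nonneg (fromℕ-nonneg r) (fromℕ-nonneg c))
  entropy-term k (suc r) (suc c) (inj₂ (refl , s≤s _ , s≤s _)) = subst₂ _≤_
    (trans (cong (λ l → N * l + N) (log-* r c)) (sym (fromℕ1* _)))
    (cong₂ _+_ (fromℕ-* (suc r) (suc c)) (sym (fromℕ1* _)))
    (log-tangent (c ℕ.+ r ℕ.* suc c) k)
    where
    N = fromℕ (suc k)
    fromℕ1* : ∀ x → fromℕ 1 * x ≡ x
    fromℕ1* x = trans (cong (_* x) (+-identityʳ 1#)) (*-identityˡ x)

  -- Summing `entropy-term` over the grid leaves N² on both sides: on the left from the N points of
  -- the set, on the right because the sum of r c factors into the sum of r times the sum of c.
  -- After cancelling N², a common factor N remains to be cancelled.
  entropy : ∀ {m n} (a : Fin m → Fin n → ℕ) → (∀ u v → a u v ≡ 0 ⊎ a u v ≡ 1) →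
    (r : Fin m → ℕ) → (∀ u → r u ≡ ℕ∑.sum (a u)) →
    (c : Fin n → ℕ) → (∀ v → c v ≡ ℕ∑.sum (λ u → a u v)) →
    ∀ k → ℕ∑.sum r ≡ suc k → ℕ∑.sum c ≡ suc k →
    sum (λ u → fromℕ (r u) * log (r u)) + sum (λ v → fromℕ (c v) * log (c v)) ≤ fromℕ (suc k) * log (suc k)
  entropy {m} {n} a a01 r r≡ c c≡ k ∑r ∑c = *-cancelˡ-≤ pN (+-cancelˡ-≤ (N * N) (begin
    N * N + N * (sum (λ u → R u * log (r u)) + sum (λ v → C v * log (c v)))
      ≈⟨ expand ⟨
    sum (λ u → sum λ v → α u v * (N * (log (r u) + log (c v)) + N))
      ≤⟨ sum-mono (λ u → sum-mono (term u)) ⟩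
    sum (λ u → sum λ v → R u * C v + α u v * (N * log (suc k)))
      ≈⟨ collect ⟩
    N * N + N * (N * log (suc k)) ∎))
    where
    open ≤-Reasoning
    N = fromℕ (suc k)
    pN = positive-fromℕ k

    R : Fin m → ℝ
    R u = fromℕ (r u)

    C : Fin n → ℝ
    C v = fromℕ (c v)

    α : Fin m → Fin n → ℝ
    α u v = fromℕ (a u v)

    ∑α : ∀ u → sum (α u) ≡ R u
    ∑α u = trans (sym (fromℕ-sum (a u))) (cong fromℕ (sym (r≡ u)))

    ∑αᵀ : ∀ v → sum (λ u → α u v) ≡ C v
    ∑αᵀ v = trans (sym (fromℕ-sum (λ u → a u v))) (cong fromℕ (sym (c≡ v)))

    ∑R : sum R ≡ N
    ∑R = trans (sym (fromℕ-sum r)) (cong fromℕ ∑r)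

    ∑C : sum C ≡ N
    ∑C = trans (sym (fromℕ-sum c)) (cong fromℕ ∑c)

    ∑∑-distrib-+ : ∀ (f g : Fin m → Fin n → ℝ) →
      sum (λ u → sum λ v → f u v + g u v) ≡ sum (λ u → sum (f u)) + sum (λ u → sum (g u))
    ∑∑-distrib-+ f g = trans (sum-cong-≗ λ u → ∑-distrib-+ (f u) (g u)) (∑-distrib-+ (sum ∘ f) (sum ∘ g))

    ∑∑-* : ∀ x → sum (λ u → sum λ v → α u v * x) ≡ N * x
    ∑∑-* x = trans (sum-cong-≗ λ u → trans (sym (*-distribʳ-sum x (α u))) (cong (_* x) (∑α u)))
               (trans (sym (*-distribʳ-sum x R)) (cong (_* x) ∑R))

    ∑∑-row : sum (λ u → sum λ v → N * (α u v * log (r u))) ≡ N * sum (λ u → R u * log (r u))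
    ∑∑-row = trans (sum-cong-≗ λ u → trans (sym (*-distribˡ-sum N λ v → α u v * log (r u)))
        (cong (N *_) (trans (sym (*-distribʳ-sum (log (r u)) (α u))) (cong (_* log (r u)) (∑α u)))))
      (sym (*-distribˡ-sum N λ u → R u * log (r u)))

    ∑∑-col : sum (λ u → sum λ v → N * (α u v * log (c v))) ≡ N * sum (λ v → C v * log (c v))
    ∑∑-col = trans (∑-comm λ u v → N * (α u v * log (c v)))
      (trans (sum-cong-≗ λ v → trans (sym (*-distribˡ-sum N λ u → α u v * log (c v)))
        (cong (N *_) (trans (sym (*-distribʳ-sum (log (c v)) λ u → α u v)) (cong (_* log (c v)) (∑αᵀ v)))))
      (sym (*-distribˡ-sum N λ v → C v * log (c v))))

    expand : sum (λ u → sum λ v → α u v * (N * (log (r u) + log (c v)) + N)) ≡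
             N * N + N * (sum (λ u → R u * log (r u)) + sum (λ v → C v * log (c v)))
    expand =
      trans (sum-cong-≗ λ u → sum-cong-≗ λ v →
        solve 4 (λ α n x y → α :* (n :* (x :+ y) :+ n) := α :* n :+ (n :* (α :* x) :+ n :* (α :* y))) refl
          (α u v) N (log (r u)) (log (c v)))
      (trans (∑∑-distrib-+ (λ u v → α u v * N) λ u v → N * (α u v * log (r u)) + N * (α u v * log (c v)))
      (cong₂ _+_ (∑∑-* N)
        (trans (∑∑-distrib-+ (λ u v → N * (α u v * log (r u))) λ u v → N * (α u v * log (c v)))
        (trans (cong₂ _+_ ∑∑-row ∑∑-col) (sym (distribˡ N _ _))))))

    collect : sum (λ u → sum λ v → R u * C v + α u v * (N * log (suc k))) ≡ N * N + N * (N * log (suc k))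
    collect = trans (∑∑-distrib-+ (λ u v → R u * C v) λ u v → α u v * (N * log (suc k)))
      (cong₂ _+_
        (trans (sum-cong-≗ λ u → trans (sym (*-distribˡ-sum (R u) C)) (cong (R u *_) ∑C))
          (trans (sym (*-distribʳ-sum N R)) (cong (_* N) ∑R)))
        (∑∑-* (N * log (suc k))))

    ≤-∑ : ∀ {n} (f : Fin n → ℕ) j → f j ≡ 1 → 1 ℕ.≤ ℕ∑.sum f
    ≤-∑ f zero    eq = ℕ.≤-trans (ℕ.≤-reflexive (sym eq)) (ℕ.m≤m+n _ _)
    ≤-∑ f (suc j) eq = ℕ.≤-trans (≤-∑ (f ∘ suc) j eq) (ℕ.m≤n+m _ (f zero))

    term : ∀ u v → α u v * (N * (log (r u) + log (c v)) + N) ≤ R u * C v + α u v * (N * log (suc k))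
    term u v with a01 u v
    ... | inj₁ eq = entropy-term k (r u) (c v) (inj₁ eq)
    ... | inj₂ eq = entropy-term k (r u) (c v) (inj₂ (eq ,
      subst (1 ℕ.≤_) (sym (r≡ u)) (≤-∑ (a u) v eq) , subst (1 ℕ.≤_) (sym (c≡ v)) (≤-∑ (λ u → a u v) u eq)))

  -- Convex combinations and weighted means

  [0,_] : ℝ → ℝ → Set
  [0, L ] x = 0# ≤ x × x ≤ L

  between : ∀ {p x q} → p ≤ x → x ≤ q →
            ∃₂ λ s t → 0# ≤ s × 0# ≤ t × s + t ≡ 1# × s * p + t * q ≡ x
  between {p} p≤x x≤q with gap p≤x | gap x≤q
  ... | d , 0≤d , refl | e , 0≤e , refl with (d + e) ≟ 0#
  ...   | yes d+e≡0 with nonneg-sum≡0 0≤d 0≤e d+e≡0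
  ...     | refl = 1# , 0# , 0≤1 , ≤-refl , +-identityʳ 1# , trans (cong (_+ 0# * (p + 0# + e)) (*-identityˡ p))
                     (solve 2 (λ p e → p :+ con 0 :* (p :+ con 0 :+ e) := p :+ con 0) refl p e)
  between {p} _ _ | d , 0≤d , refl | e , 0≤e , refl | no W≢0 =
    W ⁻¹ * e , W ⁻¹ * d , *-nonneg 0≤W⁻¹ 0≤e , *-nonneg 0≤W⁻¹ 0≤d , s+t , (begin
      W ⁻¹ * e * p + W ⁻¹ * d * (p + d + e)
        ≡⟨ solve 4 (λ w d e p → w :* e :* p :+ w :* d :* (p :+ d :+ e) := (w :* e :+ w :* d) :* p :+ w :* ((d :+ e) :* d))
              refl (W ⁻¹) d e p ⟩
      (W ⁻¹ * e + W ⁻¹ * d) * p + W ⁻¹ * (W * d)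
        ≡⟨ cong₂ _+_ (trans (cong (_* p) s+t) (*-identityˡ p)) (x⁻¹*[x*y] d W≢0) ⟩
      p + d ∎)
    where
    open ≡-Reasoning
    W = d + e
    0≤W⁻¹ = inv-nonneg (0≤+ 0≤d 0≤e) W≢0
    s+t : W ⁻¹ * e + W ⁻¹ * d ≡ 1#
    s+t = trans (solve 3 (λ w d e → w :* e :+ w :* d := (d :+ e) :* w) refl (W ⁻¹) d e) (*-inverseʳ W W≢0)

  convex-sum : ∀ {D f} → ConvexOn D f → ∀ {x y s t} → D x → D y → 0# ≤ s → 0# ≤ t → s + t ≡ 1# →
               f (s * x + t * y) ≤ s * f x + t * f y
  convex-sum {D} {f} convex {x} {y} {s} {t} dx dy 0≤s 0≤t eq =
    subst (λ t → f (s * x + t * y) ≤ s * f x + t * f y) (sym t≡1-s)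
      (convex x y s dx dy 0≤s (≤-respʳ eq (x≤x+d 0≤t)))
    where
    t≡1-s : t ≡ 1# - s
    t≡1-s = +-cancelˡ s _ _ (trans eq (sym (trans (+-comm s _) (y-x+x≡y 1# s))))

  0∈ : ∀ {L} → 0# ≤ L → [0, L ] 0#
  0∈ p = ≤-refl , p

  -- The common factor is kept on the left, so that no division occurs and all weights may vanish.
  mean₂ : ∀ {L f} → ConvexOn [0, L ] f → ∀ {a b x y} → 0# ≤ a → 0# ≤ b → [0, L ] x → [0, L ] y →
          ∃ λ z → [0, L ] z × (a + b) * z ≡ a * x + b * y × (a + b) * f z ≤ a * f x + b * f y
  mean₂ {L} {f} convex {a} {b} {x} {y} 0≤a 0≤b dx dy with (a + b) ≟ 0#
  ... | yes W≡0 with nonneg-sum≡0 0≤a 0≤b W≡0 | nonneg-sum≡0 0≤b 0≤a (trans (+-comm b a) W≡0)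
  ...   | refl | refl = x , dx , null x y , ≤-reflexive (null (f x) (f y))
    where
    null : ∀ u v → (0# + 0#) * u ≡ 0# * u + 0# * v
    null = solve 2 (λ u v → (con 0 :+ con 0) :* u := con 0 :* u :+ con 0 :* v) refl
  mean₂ {L} {f} convex {a} {b} {x} {y} 0≤a 0≤b dx dy | no W≢0 =
    s * x + t * y ,
    (0≤+ (*-nonneg 0≤s (proj₁ dx)) (*-nonneg 0≤t (proj₁ dy)) ,
     ≤-respʳ (trans (sym (distribʳ L s t)) (trans (cong (_* L) s+t) (*-identityˡ L)))
       (+-mono (*-monoˡ 0≤s (proj₂ dx)) (*-monoˡ 0≤t (proj₂ dy)))) ,
    scale x y ,
    ≤-respʳ (scale (f x) (f y)) (*-monoˡ (0≤+ 0≤a 0≤b) (convex-sum convex dx dy 0≤s 0≤t s+t))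
    where
    W = a + b
    s = W ⁻¹ * a
    t = W ⁻¹ * b
    0≤W⁻¹ = inv-nonneg (0≤+ 0≤a 0≤b) W≢0
    0≤s = *-nonneg 0≤W⁻¹ 0≤a
    0≤t = *-nonneg 0≤W⁻¹ 0≤b
    s+t : s + t ≡ 1#
    s+t = trans (solve 3 (λ w a b → w :* a :+ w :* b := (a :+ b) :* w) refl (W ⁻¹) a b) (*-inverseʳ W W≢0)
    scale : ∀ u v → W * (s * u + t * v) ≡ a * u + b * v
    scale u v = trans (solve 6 (λ W w a b u v → W :* (w :* a :* u :+ w :* b :* v) := W :* (w :* (a :* u :+ b :* v))) refl
      W (W ⁻¹) a b u v) (x*[x⁻¹*y] _ W≢0)

  mean : ∀ {L f} → 0# ≤ L → ConvexOn [0, L ] f → ∀ {k} (w x : Fin k → ℝ) →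
         (∀ j → 0# ≤ w j) → (∀ j → [0, L ] (x j)) →
         ∃ λ z → [0, L ] z × sum w * z ≡ sum (λ j → w j * x j) × sum w * f z ≤ sum (λ j → w j * f (x j))
  -- With total weight 0 every point of the interval is a mean; 0 is chosen.
  mean 0≤L convex {zero}  w x 0≤w dx = 0# , 0∈ 0≤L , zeroˡ 0# , ≤-reflexive (zeroˡ _)
  mean 0≤L convex {suc k} w x 0≤w dx
    with y , dy , y-eq , y-le ← mean 0≤L convex (w ∘ suc) (x ∘ suc) (0≤w ∘ suc) (dx ∘ suc)
    with z , dz , z-eq , z-le ← mean₂ convex (0≤w zero) (sum-nonneg (0≤w ∘ suc)) (dx zero) dy
    = z , dz , trans z-eq (cong (w zero * x zero +_) y-eq) , ≤-trans z-le (+-mono ≤-refl y-le)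

  -- The convex minorant and the induction over the factors

  ψ-isConvexMinorant : ∀ G → 1 ℕ.≤ order G → IsConvexMinorant G (ψ G)
  ψ-isConvexMinorant G 1≤m with 1 ℕ.≤? order G
  ... | yes p = proj₂ (convexMinorant G p)
  ... | no ¬p = ⊥-elim (¬p 1≤m)

  log-∈ : ∀ {m n} → m ℕ.≤ n → [0, log n ] (log m)
  log-∈ {m} m≤n = log-nonneg m , log-mono m≤n

  module _ (G : Graph) (1≤m : 1 ℕ.≤ order G) where

    private
      L = log (order G)
      f = ψ G

    ψ-convex : ConvexOn [0, L ] f
    ψ-convex = proj₁ (proj₁ (ψ-isConvexMinorant G 1≤m))

    ψ-boundary : ∀ B → fromℕ ∣ B ∣ * f (log ∣ B ∣) ≤ fromℕ (boundary G B)
    ψ-boundary B with ∣ B ∣ in eq | ∣p∣≤n B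
    -- For empty `B` the logarithm is a junk value, which the factor 0 removes.
    ... | zero  | _   = ≤-respˡ (sym (zeroˡ _)) (fromℕ-nonneg (boundary G B))
    ... | suc k | k<m = ≤-respʳ (begin
        fromℕ (suc k) * (fromℕ (boundary G B) * fromℕ ∣ B ∣ ⁻¹)
          ≡⟨ cong (λ l → fromℕ (suc k) * (fromℕ (boundary G B) * fromℕ l ⁻¹)) eq ⟩
        fromℕ (suc k) * (fromℕ (boundary G B) * fromℕ (suc k) ⁻¹)
          ≡⟨ cong (fromℕ (suc k) *_) (*-comm (fromℕ (boundary G B)) _) ⟩
        fromℕ (suc k) * (fromℕ (suc k) ⁻¹ * fromℕ (boundary G B))
          ≡⟨ x*[x⁻¹*y] _ (proj₂ (positive-fromℕ k)) ⟩
        fromℕ (boundary G B) ∎)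
      (*-monoˡ (fromℕ-nonneg (suc k)) (≤-trans
        (proj₂ (proj₁ (ψ-isConvexMinorant G 1≤m)) (suc k) (s≤s z≤n) k<m)
        (proj₂ (proj₂ (minBoundaryRatio G (suc k) k<m)) _ (B , eq , refl))))
      where open ≡-Reasoning

    ψ-nonneg : ∀ {x} → [0, L ] x → 0# ≤ f x
    ψ-nonneg = proj₂ (ψ-isConvexMinorant G 1≤m) _ (zero-lowerBound G) _

    -- The set of all vertices has no boundary, so the last of the points (log k , i_k) lies at
    -- height 0.
    ψ-end : f L ≤ 0#
    ψ-end = *-cancelˡ-≤ (positive-≤ positive-1 (≤-respˡ (+-identityʳ 1#) (fromℕ-mono 1≤m)))
      (subst₂ _≤_ (cong (λ k → fromℕ k * f (log k)) (∣⊤∣≡n (order G)))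
        (trans (cong fromℕ (boundary-⊤ G)) (sym (zeroʳ _))) (ψ-boundary ⊤))

    -- Convexity bounds the value at y by a combination of the values at x and L; the latter is at
    -- most 0, and the former is nonnegative with weight at most 1.
    ψ-antitone : ∀ {x y} → 0# ≤ x → x ≤ y → y ≤ L → f y ≤ f x
    ψ-antitone {x} 0≤x x≤y y≤L with between x≤y y≤L
    ... | s , t , 0≤s , 0≤t , s+t , refl = begin
      f (s * x + t * L)   ≤⟨ convex-sum ψ-convex dx (log-nonneg (order G) , ≤-refl) 0≤s 0≤t s+t ⟩
      s * f x + t * f L   ≤⟨ +-mono ≤-refl (*-monoˡ 0≤t ψ-end) ⟩
      s * f x + t * 0#    ≈⟨ trans (cong (s * f x +_) (zeroʳ t)) (+-identityʳ _) ⟩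
      s * f x             ≤⟨ *-monoʳ (ψ-nonneg dx) (≤-respʳ s+t (x≤x+d 0≤t)) ⟩
      1# * f x            ≈⟨ *-identityˡ (f x) ⟩
      f x                 ∎
      where
      open ≤-Reasoning
      dx : [0, L ] x
      dx = 0≤x , ≤-trans x≤y y≤L

    -- The maximum of ψ and the line through (0 , ψ 0) of slope -C is again a convex lower bound.
    ψ-slope : ∃ λ C → 0# ≤ C × (∀ x → [0, L ] x → f 0# ≤ f x + C * x)
    ψ-slope = C , *-nonneg (proj₁ (positive-⁻¹ log2-positive)) 0≤f0 , λ x dx → begin
        f 0#                     ≈⟨ cancel x ⟨
        line x + C * x
          ≤⟨ +-mono (≤-trans (x≤y⊔x (f x) (line x)) (proj₂ (ψ-isConvexMinorant G 1≤m) g (g-convex , g-below) x dx)) ≤-refl ⟩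
        f x + C * x              ∎
      where
      open ≤-Reasoning
      -- With this slope the line reaches 0 at log 2, the least positive log k. From there on it is
      -- at most 0 ≤ i_k, and at k = 1 it has the value ψ 0 ≤ i_1.
      C = log 2 ⁻¹ * f 0#
      line g : ℝ → ℝ
      line x = f 0# + - C * x
      g x = f x ⊔ line x
      0≤f0 = ψ-nonneg (0∈ (log-nonneg (order G)))

      cancel : ∀ x → line x + C * x ≡ f 0#
      cancel x = trans (solve 4 (λ a n c x → a :+ n :* x :+ c :* x := a :+ (n :+ c) :* x) refl (f 0#) (- C) C x)
        (trans (cong (λ z → f 0# + z * x) (trans (+-comm (- C) C) (-‿inverseʳ C)))
          (trans (cong (f 0# +_) (zeroˡ x)) (+-identityʳ _)))

      line-affine : ∀ x y s t → s + t ≡ 1# → line (s * x + t * y) ≡ s * line x + t * line y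
      line-affine x y s t eq = trans (cong (_+ - C * (s * x + t * y)) (sym (trans (cong (_* f 0#) eq) (*-identityˡ _))))
        (solve 6 (λ a n s t x y → (s :+ t) :* a :+ n :* (s :* x :+ t :* y) := s :* (a :+ n :* x) :+ t :* (a :+ n :* y)) refl
          (f 0#) (- C) s t x y)

      g-convex : ConvexOn [0, L ] g
      g-convex x y t dx dy 0≤t t≤1 = ⊔-lub
        (≤-trans (ψ-convex x y t dx dy 0≤t t≤1)
          (+-mono (*-monoˡ 0≤t (x≤x⊔y _ _)) (*-monoˡ (≤⇒0≤ t≤1) (x≤x⊔y _ _))))
        (≤-trans (≤-reflexive (line-affine x y t (1# - t) (trans (+-comm t _) (y-x+x≡y 1# t))))
          (+-mono (*-monoˡ 0≤t (x≤y⊔x (f x) _)) (*-monoˡ (≤⇒0≤ t≤1) (x≤y⊔x (f y) _))))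

      g-below : ∀ k → 1 ℕ.≤ k → (k≤m : k ℕ.≤ order G) → g (log k) ≤ i G k k≤m
      g-below k 1≤k k≤m = ⊔-lub (proj₂ (proj₁ (ψ-isConvexMinorant G 1≤m)) k 1≤k k≤m) (line-below k 1≤k k≤m)
        where
        line-below : ∀ k → 1 ℕ.≤ k → (k≤m : k ℕ.≤ order G) → line (log k) ≤ i G k k≤m
        line-below 1 1≤k k≤m = ≤-trans (≤-reflexive
            (trans (cong (λ z → f 0# + - C * z) log1≡0) (trans (cong (f 0# +_) (zeroʳ _))
              (trans (+-identityʳ _) (cong f (sym log1≡0))))))
          (proj₂ (proj₁ (ψ-isConvexMinorant G 1≤m)) 1 1≤k k≤m)
        line-below (suc (suc k)) 1≤k k≤m = ≤-trans
          (+-cancelˡ-≤ (C * l) (begin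
            C * l + line l          ≈⟨ trans (+-comm _ (line l)) (cancel l) ⟩
            f 0#                    ≈⟨ x*[x⁻¹*y] (f 0#) (proj₂ log2-positive) ⟨
            log 2 * C
              ≤⟨ *-monoʳ (*-nonneg (proj₁ (positive-⁻¹ log2-positive)) 0≤f0) (log-mono {2} {suc (suc k)} (s≤s (s≤s z≤n))) ⟩
            l * C                   ≈⟨ trans (*-comm l C) (sym (+-identityʳ _)) ⟩
            C * l + 0#              ∎))
          (i-nonneg G (suc (suc k)) 1≤k k≤m)
          where l = log (suc (suc k))

  -- The induction is applied to the rows of `A`, some of which may be empty; with the factor |A|
  -- kept in place, the bounds for all rows can be added. The sum of h is only bounded here, because
  -- the entropy inequality may be strict.
  isoperimetric : ∀ {n} (Gs : Fin n → Graph) → (∀ j → 1 ℕ.≤ order (Gs j)) → (A : Subset (order (□ Gs))) →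
    ∃ λ (h : Fin n → ℝ) → (∀ j → InDomain (Gs j) (h j)) ×
      fromℕ ∣ A ∣ * sum h ≤ fromℕ ∣ A ∣ * log ∣ A ∣ ×
      fromℕ ∣ A ∣ * sum (λ j → ψ (Gs j) (h j)) ≤ fromℕ (boundary (□ Gs) A)
  isoperimetric {zero} Gs 1≤m A = (λ ()) , (λ ()) , *-monoˡ (fromℕ-nonneg ∣ A ∣) (log-nonneg ∣ A ∣) ,
    ≤-respˡ (sym (zeroʳ _)) (fromℕ-nonneg (boundary (□ Gs) A))
  isoperimetric {suc n} Gs 1≤m A with ∣ A ∣ in eq
  ... | zero  = (λ _ → 0#) , (λ j → 0∈ (log-nonneg (order (Gs j)))) ,
                ≤-reflexive (trans (zeroˡ _) (sym (zeroˡ _))) , ≤-respˡ (sym (zeroˡ _)) (fromℕ-nonneg (boundary (□ Gs) A))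
  ... | suc k = z F.∷ zs , (λ { zero → z∈ ; (suc j) → zs∈ j }) , entropy-bound , boundary-bound
    where
    open ≤-Reasoning
    G = Gs zero
    H = □ (Gs ∘ suc)
    N = fromℕ (suc k)

    cols : Fin (order H) → Subset (order G)
    cols v = col {order G} A v

    rows : Fin (order G) → Subset (order H)
    rows u = row {order G} A u

    c : Fin (order H) → ℝ
    c v = fromℕ ∣ cols v ∣

    r : Fin (order G) → ℝ
    r u = fromℕ ∣ rows u ∣

    ∑c : sum c ≡ N
    ∑c = trans (sym (fromℕ-sum (∣_∣ ∘ cols))) (cong fromℕ (trans (sym (∣∣≡∑col {order G} A)) eq))

    ∑r : sum r ≡ N
    ∑r = trans (sym (fromℕ-sum (∣_∣ ∘ rows))) (cong fromℕ (trans (sym (∣∣≡∑row {order G} A)) eq))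

    ih = λ u → isoperimetric (Gs ∘ suc) (1≤m ∘ suc) (rows u)

    h : Fin (order G) → Fin n → ℝ
    h u = proj₁ (ih u)

    -- A uniform point of `A` lies in column v with probability c v / N and is then uniform there,
    -- so z is the conditional entropy of the first coordinate given the others.
    col-mean = mean (log-nonneg (order G)) (ψ-convex G (1≤m zero)) c (λ v → log ∣ cols v ∣)
      (λ v → fromℕ-nonneg ∣ cols v ∣) (λ v → log-∈ (∣p∣≤n (cols v)))
    z  = proj₁ col-mean
    z∈ = proj₁ (proj₂ col-mean)

    -- Averaging over the rows, weighted by their sizes, adds the first coordinate to those
    -- conditioned upon.
    row-mean = λ j → mean (log-nonneg (order (Gs (suc j)))) (ψ-convex (Gs (suc j)) (1≤m (suc j))) r (λ u → h u j)
      (λ u → fromℕ-nonneg ∣ rows u ∣) (λ u → proj₁ (proj₂ (ih u)) j)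
    zs  = proj₁ ∘ row-mean
    zs∈ = λ j → proj₁ (proj₂ (row-mean j))

    ∑∑-r : ∀ (x : Fin (order G) → Fin n → ℝ) →
           sum (λ j → sum λ u → r u * x u j) ≡ sum (λ u → r u * sum (x u))
    ∑∑-r x = trans (∑-comm λ j u → r u * x u j) (sum-cong-≗ λ u → sym (*-distribˡ-sum (r u) (x u)))

    entropy-bound : N * sum (z F.∷ zs) ≤ N * log (suc k)
    entropy-bound = begin
      N * (z + sum zs)
        ≈⟨ trans (distribˡ N z _) (cong (N * z +_) (*-distribˡ-sum N zs)) ⟩
      N * z + sum (λ j → N * zs j)
        ≈⟨ cong₂ _+_ (trans (cong (_* z) (sym ∑c)) (proj₁ (proj₂ (proj₂ col-mean))))
             (trans (sum-cong-≗ λ j → trans (cong (_* zs j) (sym ∑r)) (proj₁ (proj₂ (proj₂ (row-mean j))))) (∑∑-r h)) ⟩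
      sum (λ v → c v * log ∣ cols v ∣) + sum (λ u → r u * sum (h u))
        ≤⟨ +-mono ≤-refl (sum-mono λ u → proj₁ (proj₂ (proj₂ (ih u)))) ⟩
      sum (λ v → c v * log ∣ cols v ∣) + sum (λ u → r u * log ∣ rows u ∣)
        ≈⟨ +-comm _ _ ⟩
      sum (λ u → r u * log ∣ rows u ∣) + sum (λ v → c v * log ∣ cols v ∣)
        ≤⟨ entropy (λ u v → ⟦ combine u v ∈? A ⟧) (λ u v → ⟦⟧-01 (combine u v ∈? A))
             (∣_∣ ∘ rows) (∣row∣≡∑ {order G} A) (∣_∣ ∘ cols) (∣col∣≡∑ {order G} A)
             k (trans (sym (∣∣≡∑row {order G} A)) eq) (trans (sym (∣∣≡∑col {order G} A)) eq) ⟩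
      N * log (suc k) ∎

    boundary-bound : N * sum (λ j → ψ (Gs j) ((z F.∷ zs) j)) ≤ fromℕ (boundary (□ Gs) A)
    boundary-bound = begin
      N * (ψ G z + sum (λ j → ψ (Gs (suc j)) (zs j)))
        ≈⟨ trans (distribˡ N _ _) (cong (N * ψ G z +_) (*-distribˡ-sum N λ j → ψ (Gs (suc j)) (zs j))) ⟩
      N * ψ G z + sum (λ j → N * ψ (Gs (suc j)) (zs j))
        ≤⟨ +-mono (≤-respˡ (cong (_* ψ G z) ∑c) (proj₂ (proj₂ (proj₂ col-mean))))
             (sum-mono λ j → ≤-respˡ (cong (_* ψ (Gs (suc j)) (zs j)) ∑r) (proj₂ (proj₂ (proj₂ (row-mean j))))) ⟩
      sum (λ v → c v * ψ G (log ∣ cols v ∣)) + sum (λ j → sum λ u → r u * ψ (Gs (suc j)) (h u j))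
        ≈⟨ cong (sum (λ v → c v * ψ G (log ∣ cols v ∣)) +_) (∑∑-r λ u j → ψ (Gs (suc j)) (h u j)) ⟩
      sum (λ v → c v * ψ G (log ∣ cols v ∣)) + sum (λ u → r u * sum λ j → ψ (Gs (suc j)) (h u j))
        ≤⟨ +-mono (sum-mono λ v → ψ-boundary G (1≤m zero) (cols v)) (sum-mono λ u → proj₂ (proj₂ (proj₂ (ih u)))) ⟩
      sum (λ v → fromℕ (boundary G (cols v))) + sum (λ u → fromℕ (boundary H (rows u)))
        ≈⟨ sym (trans (fromℕ-+ (ℕ∑.sum (boundary G ∘ cols)) _)
             (cong₂ _+_ (fromℕ-sum (boundary G ∘ cols)) (fromℕ-sum (boundary H ∘ rows)))) ⟩
      fromℕ (ℕ∑.sum (boundary G ∘ cols) ℕ.+ ℕ∑.sum (boundary H ∘ rows))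
        ≤⟨ fromℕ-mono (boundary-□ Gs A) ⟩
      fromℕ (boundary (□ Gs) A) ∎

  -- Attainment of the minimum

  Lipschitz : ℝ → ℝ → ℝ → (ℝ → ℝ) → Set
  Lipschitz K lo hi F = ∀ s d → lo ≤ s → 0# ≤ d → s + d ≤ hi →
    F s ≤ F (s + d) + K * d × F (s + d) ≤ F s + K * d

  ≤+⇒-≤ : ∀ {x y z} → x ≤ z + y → x - z ≤ y
  ≤+⇒-≤ {x} {y} {z} p = +-cancelˡ-≤ z (≤-respˡ (sym (trans (+-comm z _) (y-x+x≡y x z))) p)

  +≤⇒≤- : ∀ {x y z} → z + y ≤ x → y ≤ x - z
  +≤⇒≤- {x} {y} {z} p = +-cancelˡ-≤ z (≤-respʳ (sym (trans (+-comm z _) (y-x+x≡y x z))) p)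

  +≡⇒≡- : ∀ {x y z} → z + y ≡ x → y ≡ x - z
  +≡⇒≡- {x} {y} {z} p = +-cancelˡ z _ _ (trans p (sym (trans (+-comm z _) (y-x+x≡y x z))))

  positive⇒x+d≰x : ∀ {x d} → Positive d → ¬ (x + d ≤ x)
  positive⇒x+d≰x {x} {d} (0≤d , d≢0) p =
    d≢0 (antisym (+-cancelˡ-≤ x (≤-respʳ (sym (+-identityʳ x)) p)) 0≤d)

  -- The supremum of the t for which F stays away from its infimum on [lo , t] is a minimiser: unlike the choice
  -- of a convergent minimising sequence, this needs no classical logic.
  minimiser : ∀ {K lo hi F} → 0# ≤ K → lo ≤ hi → Lipschitz K lo hi F →
              ∃ λ t → lo ≤ t × t ≤ hi × (∀ s → lo ≤ s → s ≤ hi → F t ≤ F s)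
  minimiser {K} {lo} {hi} {F} 0≤K lo≤hi lip = minimum
    where
    open ≤-Reasoning

    Lower : ℝ → Set
    Lower y = ∀ s → lo ≤ s → s ≤ hi → y ≤ F s

    lower : Lower (F lo - K * (hi - lo))
    lower s lo≤s s≤hi with gap lo≤s
    ... | d , 0≤d , refl = ≤+⇒-≤ (begin
      F lo                           ≤⟨ proj₁ (lip lo d ≤-refl 0≤d s≤hi) ⟩
      F (lo + d) + K * d             ≤⟨ +-mono ≤-refl (*-monoˡ 0≤K (+≤⇒≤- s≤hi)) ⟩
      F (lo + d) + K * (hi - lo)     ≈⟨ +-comm _ _ ⟩
      K * (hi - lo) + F (lo + d)     ∎)

    -- Completeness is stated for suprema, so the infimum is taken as the supremum of the lower
    -- bounds.
    infimum = complete Lower (_ , lower) (F lo , λ y y-low → y-low lo ≤-refl lo≤hi)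
    m = proj₁ infimum

    m-lower : Lower m
    m-lower s lo≤s s≤hi = proj₂ (proj₂ infimum) (F s) λ y y-low → y-low s lo≤s s≤hi

    Away : ℝ → Set
    Away t = lo ≤ t × t ≤ hi × ∃ λ y → ¬ (y ≤ m) × (∀ s → lo ≤ s → s ≤ t → y ≤ F s)

    minimum : ∃ λ t → lo ≤ t × t ≤ hi × (∀ s → lo ≤ s → s ≤ hi → F t ≤ F s)
    minimum with F lo ≤? m
    -- In this case `Away` is empty and has no supremum, but lo itself is a minimiser.
    ... | yes p = lo , ≤-refl , lo≤hi , λ s lo≤s s≤hi → ≤-trans p (m-lower s lo≤s s≤hi)
    ... | no ¬p = T , lo≤T , T≤hi , λ s lo≤s s≤hi → ≤-trans F[T]≤m (m-lower s lo≤s s≤hi)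
      where
      lo-away : Away lo
      lo-away = ≤-refl , lo≤hi , F lo , ¬p , λ s lo≤s s≤lo → ≤-reflexive (cong F (antisym lo≤s s≤lo))

      supremum = complete Away (lo , lo-away) (hi , λ _ → proj₁ ∘ proj₂)
      T = proj₁ supremum
      lo≤T = proj₁ (proj₂ supremum) lo lo-away
      T≤hi = proj₂ (proj₂ supremum) hi λ _ → proj₁ ∘ proj₂

      F[T]≤m : F T ≤ m
      F[T]≤m with F T ≤? m
      ... | yes p = p
      ... | no F[T]≰m with gap (≰⇒≥ F[T]≰m)
      ...   | e , 0≤e , F[T]≡m+e = ⊥-elim (positive⇒x+d≰x pδ (≤-respˡ (+-comm δ T)
                (≤-trans (+-mono (≤-refl {δ}) (proj₂ (proj₂ supremum) (T - δ) bound))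
                  (≤-reflexive (trans (+-comm δ _) (y-x+x≡y T δ))))))
        where
        pK+1 : Positive (K + 1#)
        pK+1 = positive-≤ positive-1 (≤-respʳ (+-comm 1# K) (x≤x+d 0≤K))
        -- Within δ of T the value F T = m + e drops by at most K δ. Taking e = (K + 1) δ leaves it
        -- at least δ above m.
        δ = (K + 1#) ⁻¹ * e
        pδ : Positive δ
        pδ = positive-* (positive-⁻¹ pK+1) (0≤e , λ { refl → F[T]≰m (≤-reflexive (trans F[T]≡m+e (+-identityʳ m))) })

        F[T] : m + δ + K * δ ≡ F T
        F[T] = trans (trans (cong (λ x → m + x + K * δ) (sym (*-identityˡ δ)))
            (solve 4 (λ m k u d → m :+ u :* d :+ k :* d := m :+ (k :+ u) :* d) refl m K 1# δ))
          (trans (cong (m +_) (x*[x⁻¹*y] e (proj₂ pK+1))) (sym F[T]≡m+e))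

        close : ∀ {d x} → d ≤ δ → F T ≤ x + K * d → m + δ ≤ x
        close {d} {x} d≤δ p = +-cancelˡ-≤ (K * δ) (begin
          K * δ + (m + δ)   ≈⟨ trans (+-comm _ _) F[T] ⟩
          F T               ≤⟨ p ⟩
          x + K * d         ≤⟨ +-mono ≤-refl (*-monoˡ 0≤K d≤δ) ⟩
          x + K * δ         ≈⟨ +-comm _ _ ⟩
          K * δ + x         ∎)

        near : ∀ s → lo ≤ s → s ≤ hi → T ≤ s + δ → s ≤ T + δ → m + δ ≤ F s
        near s lo≤s s≤hi T≤s+δ s≤T+δ with total s T
        ... | inj₁ s≤T with d , 0≤d , eq ← gap s≤T =
              close (+-cancelˡ-≤ s (≤-respˡ eq T≤s+δ))
                (≤-respˡ (cong F (sym eq)) (proj₂ (lip s d lo≤s 0≤d (≤-respˡ eq T≤hi))))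
        ... | inj₂ T≤s with d , 0≤d , refl ← gap T≤s =
              close (+-cancelˡ-≤ T s≤T+δ) (proj₁ (lip T d lo≤T 0≤d s≤hi))

        -- A point t of `Away` beyond T - δ could be prolonged to r, as F ≥ y up to t and F ≥ m + δ
        -- near T. Then r ≤ T, so r is not T + δ; and r ≡ hi would make y′ a lower bound of F above
        -- m.
        bound : UpperBound Away (T - δ)
        bound t (lo≤t , t≤hi , y , y≰m , y-low) with (δ + t) ≤? T
        ... | yes p = +≤⇒≤- p
        ... | no ¬q = ⊥-elim (absurd (⊓-sel (T + δ) hi))
          where
          T≤t+δ = ≤-respʳ (+-comm δ t) (≰⇒≥ ¬q)
          y′ = y ⊓ (m + δ)
          r = (T + δ) ⊓ hi

          y′≰m : ¬ (y′ ≤ m)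
          y′≰m p with ⊓-sel y (m + δ)
          ... | inj₁ eq = y≰m (≤-respˡ eq p)
          ... | inj₂ eq = positive⇒x+d≰x pδ (≤-respˡ eq p)

          y′-low : ∀ s → lo ≤ s → s ≤ r → y′ ≤ F s
          y′-low s lo≤s s≤r with total s t
          ... | inj₁ s≤t = ≤-trans (x⊓y≤x y _) (y-low s lo≤s s≤t)
          ... | inj₂ t≤s = ≤-trans (x⊓y≤y y _) (near s lo≤s (≤-trans s≤r (x⊓y≤y (T + δ) hi))
                (≤-trans T≤t+δ (+-mono t≤s ≤-refl)) (≤-trans s≤r (x⊓y≤x (T + δ) hi)))

          r≤T : r ≤ T
          r≤T = proj₁ (proj₂ supremum) r (⊓-glb (≤-trans lo≤T (x≤x+d (proj₁ pδ))) lo≤hi ,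
                  x⊓y≤y (T + δ) hi , y′ , y′≰m , y′-low)

          absurd : ¬ (r ≡ T + δ ⊎ r ≡ hi)
          absurd (inj₁ eq) = positive⇒x+d≰x pδ (≤-respˡ eq r≤T)
          absurd (inj₂ eq) = y′≰m (proj₁ (proj₂ infimum) y′ λ s lo≤s s≤hi → y′-low s lo≤s (≤-respʳ (sym eq) s≤hi))

  Regular : ℝ → ℝ → (ℝ → ℝ) → Set
  Regular C L f = ∀ x d → 0# ≤ x → 0# ≤ d → x + d ≤ L → f (x + d) ≤ f x × f x ≤ f (x + d) + C * d

  regular-weaken : ∀ {C C′ L f} → C ≤ C′ → Regular C L f → Regular C′ L f
  regular-weaken C≤C′ reg x d 0≤x 0≤d x+d≤L =
    proj₁ (reg x d 0≤x 0≤d x+d≤L) ,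
    ≤-trans (proj₂ (reg x d 0≤x 0≤d x+d≤L)) (+-mono ≤-refl (*-monoʳ 0≤d C≤C′))

  -- A convex nonincreasing function is steepest at 0, so the slope bound there serves everywhere: x
  -- is a combination of 0 and x + d in which the weight s of 0 satisfies s (x + d) = d.
  convex-regular : ∀ {C L f} → 0# ≤ L → ConvexOn [0, L ] f →
    (∀ {x y} → 0# ≤ x → x ≤ y → y ≤ L → f y ≤ f x) → (∀ x → [0, L ] x → f 0# ≤ f x + C * x) → Regular C L f
  convex-regular {C} {L} {f} 0≤L convex antitone slope x d 0≤x 0≤d x+d≤L =
    antitone 0≤x (x≤x+d 0≤d) x+d≤L , steep (between 0≤x (x≤x+d 0≤d))
    where
    open ≤-Reasoning
    y = x + d
    dy : [0, L ] y
    dy = 0≤+ 0≤x 0≤d , x+d≤L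
    steep : (∃₂ λ s t → 0# ≤ s × 0# ≤ t × s + t ≡ 1# × s * 0# + t * y ≡ x) → f x ≤ f y + C * d
    steep (s , t , 0≤s , 0≤t , s+t , eq) = begin
      f x                                ≈⟨ cong f eq ⟨
      f (s * 0# + t * y)                 ≤⟨ convex-sum convex (0∈ 0≤L) dy 0≤s 0≤t s+t ⟩
      s * f 0# + t * f y                 ≤⟨ +-mono (*-monoˡ 0≤s (slope y dy)) ≤-refl ⟩
      s * (f y + C * y) + t * f y
        ≈⟨ solve 5 (λ s t u c y → s :* (u :+ c :* y) :+ t :* u := (s :+ t) :* u :+ c :* (s :* y)) refl s t (f y) C y ⟩
      (s + t) * f y + C * (s * y)        ≈⟨ cong₂ (λ u v → u + C * v) (trans (cong (_* f y) s+t) (*-identityˡ _)) s*y≡d ⟩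
      f y + C * d                        ∎
      where
      s*y≡d : s * y ≡ d
      s*y≡d = +-cancelˡ x _ _ (trans (cong (_+ s * y) (sym eq))
        (trans (solve 3 (λ s t y → s :* con 0 :+ t :* y :+ s :* y := (s :+ t) :* y) refl s t y)
          (trans (cong (_* y) s+t) (*-identityˡ y))))

  ψ-regular : ∀ G → 1 ℕ.≤ order G → ∃ λ C → 0# ≤ C × Regular C (log (order G)) (ψ G)
  ψ-regular G 1≤m = let C , 0≤C , slope = ψ-slope G 1≤m in
    C , 0≤C , convex-regular (log-nonneg (order G)) (ψ-convex G 1≤m) (ψ-antitone G 1≤m) slope

  -- Spreads a change of the sum over two coordinates with room p and q; the first is filled before
  -- the second.
  distribute : ∀ {d p q} → 0# ≤ d → 0# ≤ p → 0# ≤ q → d ≤ p + q →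
               ∃₂ λ d₁ d₂ → 0# ≤ d₁ × d₁ ≤ p × 0# ≤ d₂ × d₂ ≤ q × d₁ + d₂ ≡ d
  distribute {d} {p} 0≤d 0≤p 0≤q d≤p+q with total d p
  ... | inj₁ d≤p = d , 0# , 0≤d , d≤p , ≤-refl , 0≤q , +-identityʳ d
  ... | inj₂ p≤d with gap p≤d
  ...   | e , 0≤e , refl = p , e , 0≤p , ≤-refl , 0≤e , +-cancelˡ-≤ p d≤p+q , refl

  module InfimalConvolution {C a b f g} (0≤C : 0# ≤ C) (0≤a : 0# ≤ a) (0≤b : 0# ≤ b)
                            (f-reg : Regular C a f) (g-reg : Regular C b g) where

    Attained : ℝ → ℝ → Set
    Attained x m = (∃₂ λ s t → [0, a ] s × [0, b ] t × s + t ≡ x × m ≡ f s + g t) ×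
                   (∀ s t → [0, a ] s → [0, b ] t → s + t ≡ x → m ≤ f s + g t)

    x-s≤b : ∀ x {s} → 0# ⊔ (x - b) ≤ s → x - s ≤ b
    x-s≤b x lo≤s = ≤+⇒-≤ (≤-respˡ (y-x+x≡y x b) (+-mono (≤-trans (x≤y⊔x 0# (x - b)) lo≤s) ≤-refl))

    -- As s grows by d, f s falls and g (x - s) rises, each by at most C d. The changes have
    -- opposite signs, so the constant is C rather than 2 C. The bounds on s express that s and x -
    -- s lie in their intervals.
    split-lipschitz : ∀ x → Lipschitz C (0# ⊔ (x - b)) (a ⊓ x) (λ s → f s + g (x - s))
    split-lipschitz x s d lo≤s 0≤d s+d≤hi =
      subst (λ u → f s + g u ≤ f (s + d) + g t + C * d × f (s + d) + g t ≤ f s + g u + C * d) t+d≡x-s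
        (≤-respʳ (solve 3 (λ u v w → u :+ w :+ v := u :+ v :+ w) refl (f (s + d)) (g t) (C * d))
          (+-mono (proj₂ f-sd) (proj₁ g-td)) ,
         ≤-respʳ (sym (+-assoc (f s) _ _)) (+-mono (proj₁ f-sd) (proj₂ g-td)))
      where
      t = x - (s + d)
      t+d≡x-s : t + d ≡ x - s
      t+d≡x-s = +≡⇒≡- (trans (solve 3 (λ s t d → s :+ (t :+ d) := t :+ (s :+ d)) refl s t d) (y-x+x≡y x (s + d)))
      f-sd = f-reg s d (≤-trans (x≤x⊔y 0# _) lo≤s) 0≤d (≤-trans s+d≤hi (x⊓y≤x a x))
      g-td = g-reg t d (≤⇒0≤ (≤-trans s+d≤hi (x⊓y≤y a x))) 0≤d (≤-respˡ (sym t+d≡x-s) (x-s≤b x lo≤s))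

    attain : ∀ x → [0, a + b ] x → ∃ (Attained x)
    attain x (0≤x , x≤a+b) = best (minimiser 0≤C lo≤hi (split-lipschitz x))
      where
      lo≤hi : 0# ⊔ (x - b) ≤ a ⊓ x
      lo≤hi = ⊔-lub (⊓-glb 0≤a 0≤x)
        (⊓-glb (≤+⇒-≤ (≤-respʳ (+-comm a b) x≤a+b)) (≤+⇒-≤ (≤-respʳ (+-comm x b) (x≤x+d 0≤b))))
      best : (∃ λ s → 0# ⊔ (x - b) ≤ s × s ≤ a ⊓ x ×
                      (∀ s′ → 0# ⊔ (x - b) ≤ s′ → s′ ≤ a ⊓ x → f s + g (x - s) ≤ f s′ + g (x - s′))) →
             ∃ (Attained x)
      best (s , lo≤s , s≤hi , least) = f s + g (x - s) ,
        (s , x - s , (≤-trans (x≤x⊔y 0# _) lo≤s , ≤-trans s≤hi (x⊓y≤x a x)) ,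
          (≤⇒0≤ (≤-trans s≤hi (x⊓y≤y a x)) , x-s≤b x lo≤s) , trans (+-comm s _) (y-x+x≡y x s) , refl) ,
        λ { s′ t′ (0≤s′ , s′≤a) (0≤t′ , t′≤b) eq →
              ≤-respʳ (cong (λ u → f s′ + g u) (sym (+≡⇒≡- eq)))
                (least s′ (⊔-lub 0≤s′ (≤+⇒-≤ (subst₂ _≤_ eq (+-comm s′ b) (+-mono ≤-refl t′≤b))))
                  (⊓-glb s′≤a (≤-respʳ eq (x≤x+d 0≤t′)))) }

    value : ℝ → ℝ
    value x with (0# ≤? x) ×-dec (x ≤? a + b)
    ... | yes d = proj₁ (attain x d)
    ... | no  _ = 0#

    value-attained : ∀ x → [0, a + b ] x → Attained x (value x)
    value-attained x d with (0# ≤? x) ×-dec (x ≤? a + b)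
    ... | yes d′ = proj₂ (attain x d′)
    ... | no  ¬d = ⊥-elim (¬d d)

    interchange : ∀ s p t q → s + p + (t + q) ≡ s + t + (p + q)
    interchange = solve 4 (λ s p t q → s :+ p :+ (t :+ q) := s :+ t :+ (p :+ q)) refl

    -- An optimal split at x can be raised to a split of x + d, which increases neither f nor g. An
    -- optimal split at x + d can be lowered to one of x, at a total cost of at most C d.
    value-regular : Regular C (a + b) value
    value-regular x d 0≤x 0≤d x+d≤L = down (proj₁ at-x) , up (proj₁ at-x+d)
      where
      open ≤-Reasoning
      at-x   = value-attained x (0≤x , ≤-trans (x≤x+d 0≤d) x+d≤L)
      at-x+d = value-attained (x + d) (0≤+ 0≤x 0≤d , x+d≤L)

      down : (∃₂ λ s t → [0, a ] s × [0, b ] t × s + t ≡ x × value x ≡ f s + g t) → value (x + d) ≤ value x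
      down (s , t , (0≤s , s≤a) , (0≤t , t≤b) , s+t , v-eq) = move (gap s≤a) (gap t≤b)
        where
        move : (∃ λ p → 0# ≤ p × a ≡ s + p) → (∃ λ q → 0# ≤ q × b ≡ t + q) → value (x + d) ≤ value x
        move (p , 0≤p , a≡) (q , 0≤q , b≡) = moved (distribute 0≤d 0≤p 0≤q (+-cancelˡ-≤ x
            (≤-respʳ (trans (cong₂ _+_ a≡ b≡) (trans (interchange s p t q) (cong (_+ (p + q)) s+t))) x+d≤L)))
          where
          moved : (∃₂ λ d₁ d₂ → 0# ≤ d₁ × d₁ ≤ p × 0# ≤ d₂ × d₂ ≤ q × d₁ + d₂ ≡ d) → value (x + d) ≤ value x
          moved (d₁ , d₂ , 0≤d₁ , d₁≤p , 0≤d₂ , d₂≤q , d₁+d₂) = begin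
            value (x + d)            ≤⟨ proj₂ at-x+d (s + d₁) (t + d₂) (0≤+ 0≤s 0≤d₁ , s+d₁≤a) (0≤+ 0≤t 0≤d₂ , t+d₂≤b)
                                          (trans (interchange s d₁ t d₂) (cong₂ _+_ s+t d₁+d₂)) ⟩
            f (s + d₁) + g (t + d₂)  ≤⟨ +-mono (proj₁ (f-reg s d₁ 0≤s 0≤d₁ s+d₁≤a)) (proj₁ (g-reg t d₂ 0≤t 0≤d₂ t+d₂≤b)) ⟩
            f s + g t                ≈⟨ v-eq ⟨
            value x                  ∎
            where
            s+d₁≤a = ≤-respʳ (sym a≡) (+-mono ≤-refl d₁≤p)
            t+d₂≤b = ≤-respʳ (sym b≡) (+-mono ≤-refl d₂≤q)

      up : (∃₂ λ s t → [0, a ] s × [0, b ] t × s + t ≡ x + d × value (x + d) ≡ f s + g t) →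
           value x ≤ value (x + d) + C * d
      up (s′ , t′ , (0≤s′ , s′≤a) , (0≤t′ , t′≤b) , s′+t′ , v-eq) =
        move (distribute 0≤d 0≤s′ 0≤t′ (≤-respʳ (trans (+-comm d x) (sym s′+t′)) (x≤x+d 0≤x)))
        where
        move : (∃₂ λ d₁ d₂ → 0# ≤ d₁ × d₁ ≤ s′ × 0# ≤ d₂ × d₂ ≤ t′ × d₁ + d₂ ≡ d) → value x ≤ value (x + d) + C * d
        move (d₁ , d₂ , 0≤d₁ , d₁≤s′ , 0≤d₂ , d₂≤t′ , d₁+d₂) = moved (gap d₁≤s′) (gap d₂≤t′)
          where
          moved : (∃ λ s → 0# ≤ s × s′ ≡ d₁ + s) → (∃ λ t → 0# ≤ t × t′ ≡ d₂ + t) → value x ≤ value (x + d) + C * d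
          moved (s , 0≤s , s′≡) (t , 0≤t , t′≡) = begin
            value x
              ≤⟨ proj₂ at-x s t (0≤s , ≤-trans (x≤x+d 0≤d₁) s+d₁≤a) (0≤t , ≤-trans (x≤x+d 0≤d₂) t+d₂≤b) s+t ⟩
            f s + g t
              ≤⟨ +-mono (proj₂ (f-reg s d₁ 0≤s 0≤d₁ s+d₁≤a)) (proj₂ (g-reg t d₂ 0≤t 0≤d₂ t+d₂≤b)) ⟩
            f (s + d₁) + C * d₁ + (g (t + d₂) + C * d₂)
              ≈⟨ trans (interchange (f (s + d₁)) (C * d₁) (g (t + d₂)) (C * d₂))
                   (cong (f (s + d₁) + g (t + d₂) +_)
                     (trans (sym (distribˡ C d₁ d₂)) (cong (C *_) d₁+d₂))) ⟩
            f (s + d₁) + g (t + d₂) + C * d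
              ≈⟨ cong (_+ C * d) (trans (cong₂ (λ u v → f u + g v) s+d₁ t+d₂) (sym v-eq)) ⟩
            value (x + d) + C * d                          ∎
            where
            s+d₁ : s + d₁ ≡ s′
            s+d₁ = trans (+-comm s d₁) (sym s′≡)
            t+d₂ : t + d₂ ≡ t′
            t+d₂ = trans (+-comm t d₂) (sym t′≡)
            s+d₁≤a = ≤-respˡ (sym s+d₁) s′≤a
            t+d₂≤b = ≤-respˡ (sym t+d₂) t′≤b
            s+t : s + t ≡ x
            s+t = +-cancelˡ d _ _ (trans (+-comm d (s + t)) (trans (cong (s + t +_) (sym d₁+d₂))
              (trans (sym (interchange s d₁ t d₂)) (trans (cong₂ _+_ s+d₁ t+d₂) (trans s′+t′ (+-comm x d))))))

  Feasible : ∀ {n} → (Fin n → ℝ) → ℝ → (Fin n → ℝ) → Set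
  Feasible L x h = (∀ j → [0, L j ] (h j)) × sum h ≡ x

  -- The minimum is constructed as a function `M` of the prescribed sum, with its regularity, since
  -- the next factor is convolved with this whole function.
  minimum : ∀ {n} (L : Fin n → ℝ) (f : Fin n → ℝ → ℝ) → (∀ j → 0# ≤ L j) →
    (∀ j → ∃ λ C → 0# ≤ C × Regular C (L j) (f j)) →
    ∃ λ M → (∃ λ C → 0# ≤ C × Regular C (sum L) M) × (∀ x → [0, sum L ] x →
      (∃ λ h → Feasible L x h × M x ≡ sum (λ j → f j (h j))) ×
      (∀ h → Feasible L x h → M x ≤ sum (λ j → f j (h j))))
  minimum {zero} L f 0≤L reg = (λ _ → 0#) ,
    (0# , ≤-refl , λ _ d _ _ _ → ≤-refl , x≤x+d (≤-reflexive (sym (zeroˡ d)))) ,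
    λ x (0≤x , x≤0) → ((λ ()) , ((λ ()) , antisym 0≤x x≤0) , refl) , λ _ _ → ≤-refl
  minimum {suc n} L f 0≤L reg
    with C , 0≤C , f-reg ← reg zero
    with M , (C′ , 0≤C′ , M-reg) , M-min ← minimum (L ∘ suc) (f ∘ suc) (0≤L ∘ suc) (reg ∘ suc)
    = value , (C + C′ , 0≤+ 0≤C 0≤C′ , value-regular) , λ x dx → attained x dx , least x dx
    where
    open InfimalConvolution (0≤+ 0≤C 0≤C′) (0≤L zero) (sum-nonneg (0≤L ∘ suc))
      (regular-weaken {L = L zero} {f zero} (x≤x+d 0≤C′) f-reg)
      (regular-weaken {L = sum (L ∘ suc)} {M} (≤-respʳ (+-comm C′ C) (x≤x+d 0≤C)) M-reg)

    attained : ∀ x → [0, sum L ] x → ∃ λ h → Feasible L x h × value x ≡ sum (λ j → f j (h j))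
    attained x dx with proj₁ (value-attained x dx)
    ... | s , t , ds , dt , s+t , eq with proj₁ (M-min t dt)
    ...   | h , (dh , ∑h) , eq′ = s F.∷ h , ((λ { zero → ds ; (suc j) → dh j }) , trans (cong (s +_) ∑h) s+t) ,
            trans eq (cong (f zero s +_) eq′)

    least : ∀ x → [0, sum L ] x → ∀ h → Feasible L x h → value x ≤ sum (λ j → f j (h j))
    least x dx h (dh , ∑h) = ≤-trans (proj₂ (value-attained x dx) (h zero) (sum (h ∘ suc)) (dh zero) tail∈ ∑h)
      (+-mono ≤-refl (proj₂ (M-min (sum (h ∘ suc)) tail∈) (h ∘ suc) (dh ∘ suc , refl)))
      where
      tail∈ : [0, sum (L ∘ suc) ] (sum (h ∘ suc))
      tail∈ = sum-nonneg (proj₁ ∘ dh ∘ suc) , sum-mono (proj₂ ∘ dh ∘ suc)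

  -- Feasible points and the two final bounds

  log-*′ : ∀ {a b} → 1 ℕ.≤ a → 1 ℕ.≤ b → log (a ℕ.* b) ≡ log a + log b
  log-*′ {suc a} {suc b} _ _ = log-* a b

  log-tupleCount : ∀ {n} (Gs : Fin n → Graph) → (∀ j → 1 ℕ.≤ order (Gs j)) →
    1 ℕ.≤ tupleCount Gs × log (tupleCount Gs) ≡ sum (λ j → log (order (Gs j)))
  log-tupleCount {zero}  Gs 1≤m = s≤s z≤n , log1≡0
  log-tupleCount {suc n} Gs 1≤m with 1≤t , eq ← log-tupleCount (Gs ∘ suc) (1≤m ∘ suc) =
    ℕ.*-mono-≤ (1≤m zero) 1≤t , trans (log-*′ (1≤m zero) 1≤t) (cong (log (order (Gs zero)) +_) eq)

  positive-fromℕ′ : ∀ {k} → 1 ℕ.≤ k → Positive (fromℕ k)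
  positive-fromℕ′ {suc k} _ = positive-fromℕ k

  module _ {n} (Gs : Fin n → Graph) (A : Subset (order (□ Gs))) (A≢∅ : Nonempty A) where

    private
      1≤m = orders-positive Gs (proj₁ A≢∅)

      L : Fin n → ℝ
      L j = log (order (Gs j))

    log∣∣-∈ : [0, sum L ] (log ∣ A ∣)
    log∣∣-∈ = log-nonneg ∣ A ∣ , ≤-respʳ (proj₂ (log-tupleCount Gs 1≤m)) (log-mono (∣p∣≤n A))

    feasible-isoperimetric : ∃ λ h → Feasible L (log ∣ A ∣) h ×
      fromℕ ∣ A ∣ * sum (λ j → ψ (Gs j) (h j)) ≤ fromℕ (boundary (□ Gs) A)
    feasible-isoperimetric = raise (isoperimetric Gs 1≤m A)
      where
      Bound : (Fin n → ℝ) → Set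
      Bound h = fromℕ ∣ A ∣ * sum (λ j → ψ (Gs j) (h j)) ≤ fromℕ (boundary (□ Gs) A)

      -- All coordinates move towards their upper ends in the same proportion, which keeps them in
      -- their intervals and reaches the sum log |A|, a number between the sum of h and the sum of
      -- `L`.
      interpolate : ∀ h → (∀ j → [0, L j ] (h j)) → Bound h →
        (∃₂ λ s t → 0# ≤ s × 0# ≤ t × s + t ≡ 1# × s * sum h + t * sum L ≡ log ∣ A ∣) →
        ∃ λ h → Feasible L (log ∣ A ∣) h × Bound h
      interpolate h dh h-le (s , t , 0≤s , 0≤t , s+t , eq) = h′ ,
        ((λ j → ≤-trans (proj₁ (dh j)) (h≤h′ j) , h′≤L j) ,
         trans (∑-distrib-+ (λ j → s * h j) (λ j → t * L j))
           (trans (cong₂ _+_ (sym (*-distribˡ-sum s h)) (sym (*-distribˡ-sum t L))) eq)) ,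
        ≤-trans (*-monoˡ (fromℕ-nonneg ∣ A ∣)
          (sum-mono λ j → ψ-antitone (Gs j) (1≤m j) (proj₁ (dh j)) (h≤h′ j) (h′≤L j))) h-le
        where
        h′ : Fin n → ℝ
        h′ j = s * h j + t * L j
        diagonal : ∀ x → s * x + t * x ≡ x
        diagonal x = trans (sym (distribʳ x s t)) (trans (cong (_* x) s+t) (*-identityˡ x))
        h≤h′ : ∀ j → h j ≤ h′ j
        h≤h′ j = ≤-respˡ (diagonal (h j)) (+-mono ≤-refl (*-monoˡ 0≤t (proj₂ (dh j))))
        h′≤L : ∀ j → h′ j ≤ L j
        h′≤L j = ≤-respʳ (diagonal (L j)) (+-mono (*-monoˡ 0≤s (proj₂ (dh j))) ≤-refl)

      raise : (∃ λ h → (∀ j → [0, L j ] (h j)) × fromℕ ∣ A ∣ * sum h ≤ fromℕ ∣ A ∣ * log ∣ A ∣ × Bound h) →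
              ∃ λ h → Feasible L (log ∣ A ∣) h × Bound h
      raise (h , dh , ∑h≤ , h-le) = interpolate h dh h-le
        (between (*-cancelˡ-≤ (positive-fromℕ′ (nonempty-∣∣ (proj₂ A≢∅))) ∑h≤) (proj₂ log∣∣-∈))

  jensen : ∀ {L f} → 0# ≤ L → ConvexOn [0, L ] f → ∀ {n} → 1 ℕ.≤ n → (h : Fin n → ℝ) → (∀ j → [0, L ] (h j)) →
           fromℕ n * f (sum h * fromℕ n ⁻¹) ≤ sum (λ j → f (h j))
  jensen {L} {f} 0≤L convex {n} 1≤n h dh with mean 0≤L convex (λ _ → 1#) h (λ _ → 0≤1) dh
  ... | z , _ , z-eq , z-le = subst₂ _≤_
      (cong₂ (λ w y → w * f y) (sum-replicate n) (*-cancelˡ-≡ (proj₂ pn) (begin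
        fromℕ n * z                       ≡⟨ cong (_* z) (sum-replicate n) ⟨
        sum {n} (λ _ → 1#) * z            ≡⟨ z-eq ⟩
        sum (λ j → 1# * h j)              ≡⟨ sum-cong-≗ (λ j → *-identityˡ (h j)) ⟩
        sum h                             ≡⟨ x*[x⁻¹*y] (sum h) (proj₂ pn) ⟨
        fromℕ n * (fromℕ n ⁻¹ * sum h)    ≡⟨ cong (fromℕ n *_) (*-comm _ (sum h)) ⟩
        fromℕ n * (sum h * fromℕ n ⁻¹)    ∎)))
      (sum-cong-≗ λ j → *-identityˡ (f (h j))) z-le
    where
    open ≡-Reasoning
    pn = positive-fromℕ′ 1≤n

  isoperimetric-minimum : ∀ {n} (Gs : Fin n → Graph) A → Nonempty A → ∃ λ μ →
    IsMinimum (λ s → ∃ λ h → (∀ j → InDomain (Gs j) (h j)) × sum h ≡ log ∣ A ∣ × s ≡ sum (λ j → ψ (Gs j) (h j))) μ ×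
    fromℕ ∣ A ∣ * μ ≤ fromℕ (boundary (□ Gs) A)
  isoperimetric-minimum Gs A A≢∅ =
    let 1≤m = orders-positive Gs (proj₁ A≢∅)
        M , _ , M-min = minimum (log ∘ order ∘ Gs) (ψ ∘ Gs) (log-nonneg ∘ order ∘ Gs) (λ j → ψ-regular (Gs j) (1≤m j))
        (h , (dh , ∑h) , eq) , least = M-min (log ∣ A ∣) (log∣∣-∈ Gs A A≢∅)
        h′ , feasible , le = feasible-isoperimetric Gs A A≢∅
    in M (log ∣ A ∣) , ((h , dh , ∑h , eq) , λ { _ (k , dk , ∑k , refl) → least k (dk , ∑k) }) ,
       ≤-trans (*-monoˡ (fromℕ-nonneg ∣ A ∣) (least h′ feasible)) le

  -- Jensen's inequality is applied to the feasible h supplied by `feasible-isoperimetric`, whose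
  -- average is (log |A|)/n.
  isoperimetric-power : ∀ n .{{_ : NonZero n}} G A → Nonempty A →
    fromℕ ∣ A ∣ * fromℕ n * ψ G (log ∣ A ∣ * fromℕ n ⁻¹) ≤ fromℕ (boundary (□ {n} (λ _ → G)) A)
  isoperimetric-power n G A A≢∅ = let h , (dh , ∑h) , le = feasible-isoperimetric (λ _ → G) A A≢∅ in begin
    fromℕ ∣ A ∣ * fromℕ n * ψ G (log ∣ A ∣ * fromℕ n ⁻¹)     ≈⟨ *-assoc _ _ _ ⟩
    fromℕ ∣ A ∣ * (fromℕ n * ψ G (log ∣ A ∣ * fromℕ n ⁻¹))
      ≈⟨ cong (λ x → fromℕ ∣ A ∣ * (fromℕ n * ψ G (x * fromℕ n ⁻¹))) ∑h ⟨
    fromℕ ∣ A ∣ * (fromℕ n * ψ G (sum h * fromℕ n ⁻¹))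
      ≤⟨ *-monoˡ (fromℕ-nonneg ∣ A ∣)
           (jensen (log-nonneg (order G)) (ψ-convex G 1≤m) 1≤n h dh) ⟩
    fromℕ ∣ A ∣ * sum (λ j → ψ G (h j))                      ≤⟨ le ⟩
    fromℕ (boundary (□ {n} (λ _ → G)) A)                     ∎
    where
    open ≤-Reasoning
    1≤n = ℕ.>-nonZero⁻¹ n
    1≤m = orders-positive {n} (λ _ → G) (proj₁ A≢∅) (Fin.fromℕ< 1≤n)

theorem1 : (reals : CompleteOrderedField) (n : ℕ) .{{_ : NonZero n}} →
    let open Analysis reals in
    ((Gs : Fin n → Graph) (A : Subset (Graph.order (□ Gs))) → Nonempty A →
    ∃ λ μ →
    IsMinimum
    (λ s → ∃ λ (h : Fin n → ℝ) →
    (∀ j → 0# ≤ h j × h j ≤ log (Graph.order (Gs j))) ×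
    sum h ≡ log ∣ A ∣ ×
    s ≡ sum (λ j → ψ (Gs j) (h j)))
    μ ×
    fromℕ ∣ A ∣ * μ ≤ fromℕ (Graph.boundary (□ Gs) A))
    ×
    ((G : Graph) (A : Subset (Graph.order (□ {n} (λ _ → G)))) → Nonempty A →
    fromℕ ∣ A ∣ * fromℕ n * ψ G (log ∣ A ∣ * fromℕ n ⁻¹)
    ≤ fromℕ (Graph.boundary (□ {n} (λ _ → G)) A))
theorem1 reals n = Proof.isoperimetric-minimum reals , Proof.isoperimetric-power reals n
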